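{- Let $\mathbb F$ be a finite field of odd order and let $Q=Q_{a,b}$ be a quadratic quasigroup upon $\mathbb F$. Then: (i) $Q$ is medial (satisfies $xy\cdot uv=xu\cdot yv$) if and only if $a=b$; (ii) $Q$ is left distributive (satisfies $x\cdot yz=xy\cdot xz$) if and only if $a=b$; (iii) $Q$ is right distributive (satisfies $xy\cdot z=xz\cdot yz$) if and only if $a=b$; (iv) $Q$ is commutative if and only if $a+b=1$ and either $|\mathbb F|\equiv3\pmod 4$ or $a=b$; (v) $Q$ is flexible (satisfies $x\cdot yx=xy\cdot x$) if and only if $a=b$, or $\chi(a)=\chi(1-a)=1$, or both $a+b=1$ and $|\mathbb F|\equiv3\pmod4$; (vi) $Q$ is semisymmetric (satisfies $xy\cdot x=y$) if and only if $a^2-a+1=0$ and either $a=b$ or $a+b=1$; (vii) $Q$ is a Steiner quasigroup (idempotent, commutative and semisymmetric) if and only if either $\operatorname{char}(\mathbb F)=3$ and $a=b=-1$, or $\operatorname{char}(\mathbb F)>3$, $a+b=ab=1$ and $\chi(a)=\chi(-1)=-1$; in the latter case $a\ne b$; (viii) $Q$ is isotopic to a group if and only if $a=b$.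
   Context: $\chi$ is the quadratic character of $\mathbb F$ ($\chi(0)=0$, $1$ on nonzero squares, $-1$ on nonsquares). For $a,b\in\mathbb F$ with $\chi(a)=\chi(b)\ne0$ and $\chi(1-a)=\chi(1-b)\ne0$, $Q_{a,b}$ is $(\mathbb F,*)$ with $x*y=x+a(y-x)$ if $\chi(y-x)\ge0$ and $x*y=x+b(y-x)$ if $\chi(y-x)=-1$. Juxtaposition denotes the operation $*$. -}

module Defs where

open import Level using (0ℓ) renaming (suc to lsuc)
open import Algebra.Bundles using (Group)
open import Algebra.Structures using (IsCommutativeRing)
open import Data.Nat using (ℕ; zero; suc; _<_)
open import Data.Integer as ℤ using (ℤ; 0ℤ; 1ℤ; -1ℤ)
open import Data.Bool using (if_then_else_)
open import Data.List using (List; length)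
open import Data.List.Membership.Propositional using (_∈_)
open import Data.List.Relation.Unary.Any using (any?)
open import Data.List.Relation.Unary.Unique.Propositional using (Unique)
open import Data.Product using (Σ; ∃; _×_; _,_)
open import Function.Bundles using (Bijection)
open import Relation.Nullary using (¬_; yes; no; does)
open import Relation.Binary.Definitions using (DecidableEquality)
open import Relation.Binary.PropositionalEquality using (_≡_; _≢_) renaming (setoid to ≡-setoid)

record FiniteField : Set₁ where
  infixl 6 _+_ _-_
  infixl 7 _*_
  infix 8 -_
  infix 4 _≟_
  field
    Carrier : Set
    _+_ _*_ : Carrier → Carrier → Carrier
    -_      : Carrier → Carrier
    0# 1#   : Carrier
    isCommutativeRing : IsCommutativeRing _≡_ _+_ _*_ -_ 0# 1#
    0≢1     : 0# ≢ 1#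
    inverse : ∀ x → x ≢ 0# → ∃ λ y → x * y ≡ 1#
    _≟_     : DecidableEquality Carrier
    elements : List Carrier
    complete : ∀ x → x ∈ elements
    unique   : Unique elements

  _-_ : Carrier → Carrier → Carrier
  x - y = x + (- y)

  order : ℕ
  order = length elements

  ι : ℕ → Carrier
  ι zero    = 0#
  ι (suc n) = 1# + ι n

  HasCharacteristic : ℕ → Set
  HasCharacteristic p = 0 < p × ι p ≡ 0# × (∀ m → 0 < m → m < p → ι m ≢ 0#)

  χ : Carrier → ℤ
  χ x with x ≟ 0#
  ... | yes _ = 0ℤ
  ... | no _ with any? (λ y → y * y ≟ x) elements
  ...   | yes _ = 1ℤ
  ...   | no _  = -1ℤ

  quadOp : Carrier → Carrier → Carrier → Carrier → Carrier
  quadOp a b x y =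
    if does (0ℤ ℤ.≤? χ (y - x)) then x + a * (y - x) else x + b * (y - x)

module _ {A : Set} (_∙_ : A → A → A) where
  Semisymmetric : Set
  Semisymmetric = ∀ x y → ((x ∙ y) ∙ x) ≡ y

  LeftDistributive : Set
  LeftDistributive = ∀ x y z → (x ∙ (y ∙ z)) ≡ ((x ∙ y) ∙ (x ∙ z))

  RightDistributive : Set
  RightDistributive = ∀ x y z → ((x ∙ y) ∙ z) ≡ ((x ∙ z) ∙ (y ∙ z))

  IsotopicToGroup : Set₁
  IsotopicToGroup =
    Σ (Group 0ℓ 0ℓ) λ G →
      let open Group G using (_≈_) renaming (_∙_ to _·_) in
      Σ (Bijection (≡-setoid A) (Group.setoid G)) λ α →
      Σ (Bijection (≡-setoid A) (Group.setoid G)) λ β →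
      Σ (Bijection (≡-setoid A) (Group.setoid G)) λ γ →
        ∀ x y → Bijection.to γ (x ∙ y) ≈ (Bijection.to α x · Bijection.to β y)

{-# OPTIONS --safe #-}
-- Write x ∘ y = x + f(y - x), where f multiplies squares by a and nonsquares by b. Everything rests on
-- the translations and the multiplications by nonzero squares being automorphisms, and on the opposite
-- of Q_{a,b} being Q_{1-a,1-b} or Q_{1-b,1-a} according as -1 is a square or not. Identities in two
-- variables thus become identities between composites of such maps f, which are decided by their values
-- on 1 and on one nonsquare.
--
-- Left distributivity says that f is an automorphism. If a is a square and a ≠ b, the set of squares
-- (with 0) would then be a subquasigroup with (q + 1)/2 > q/2 elements. If a is a nonsquare and a ≠ b,
-- every square z ≠ 1 satisfies (a + b)(z - 1) = -1; comparing z with 1/z gives a⁴ = b⁴ = 1, which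
-- contradicts the hypothesis on 1 - a and 1 - b.
--
-- If Q is isotopic to a group G, one may identify F with G so that 0 is the identity and
-- x ∘ y = (x ∘ 0)·(0 ∘ y). Translations are autotopisms of G, so t + u = t·θ_t(u) for an action θ of (F,+),
-- which is equivariant for the multiplications by squares. The orbits having as many elements as the orbit
-- of 1 cover q - 1 or (q - 1)/2 elements, so this number divides q - 1 as well as q, and 1 is a fixed point.
-- The fixed points are closed under differences and under multiplication by squares, so θ is trivial and
-- G is (F,+) up to order of factors; hence f is additive and a = b.
module Submission where

open import Defs
open import Data.Nat using (ℕ; _<_; _%_)
open import Data.Integer using (0ℤ; 1ℤ; -1ℤ)
open import Data.Product using (Σ; _×_)
open import Data.Sum using (_⊎_)
open import Function.Bundles using (_⇔_)
open import Relation.Binary.PropositionalEquality using (_≡_; _≢_)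
open import Algebra.Definitions using (Medial; Commutative; Flexible; Idempotent)
open import Algebra.Bundles using (CommutativeRing; Group)
import Algebra.Properties.AbelianGroup
import Algebra.Properties.Group
import Algebra.Properties.Ring
import Algebra.Properties.Semiring.Mult.TCOptimised
import Algebra.Solver.Ring
open import Algebra.Solver.Ring.AlmostCommutativeRing using (_-Raw-AlmostCommutative⟶_; fromCommutativeRing)
open import Data.Bool using (true; false; if_then_else_)
open import Data.Empty using (⊥)
open import Data.Fin using (Fin; toℕ)
open import Data.Fin.Properties using (pigeonhole)
open import Data.Integer as ℤ using (ℤ; +_; -[1+_])
import Data.Integer.Properties as ℤₚ
open import Data.List using (List; []; _∷_; _++_; length; filter; map; lookup)
open import Data.List.Properties using (length-++; length-filter; length-map; filter-reject)
import Data.List.Membership.DecPropositional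
open import Data.List.Membership.Propositional using (_∈_; lose)
open import Data.List.Membership.Propositional.Properties using (∈-∃++; ∈-++⁻; ∈-++⁺ˡ; ∈-++⁺ʳ; ∈-filter⁺; ∈-filter⁻; ∈-map⁺; ∈-map⁻)
open import Data.List.Relation.Unary.All using ([]; _∷_)
open import Data.List.Relation.Unary.All.Properties using (¬Any⇒All¬)
open import Data.List.Relation.Unary.AllPairs using ([]; _∷_)
open import Data.List.Relation.Unary.Any as Any using (any?; here; there; satisfied)
open import Data.List.Relation.Unary.Any.Properties using (lookup-index)
open import Data.List.Relation.Unary.Unique.Propositional using (Unique)
open import Data.List.Relation.Unary.Unique.Propositional.Properties using (Unique[x∷xs]⇒x∉xs; filter⁺; map⁺)
open import Data.Maybe using (Maybe; just; nothing)
open import Data.Nat as ℕ using (zero; suc; _≤_; z≤n; s≤s)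
open import Data.Nat.Divisibility using (_∣_; divides; _∣0; ∣-refl; ∣-trans; ∣m∣n⇒∣m+n; ∣m+n∣m⇒∣n; ∣1⇒≡1; m∣m*n; n∣m⇒m%n≡0)
open import Data.Nat.DivMod using ([m+kn]%n≡m%n)
import Data.Nat.Properties as ℕₚ
open import Data.Product using (∃; _,_; proj₁; proj₂)
import Data.Sign as Sign
open import Data.Sum as Sum using (inj₁; inj₂)
open import Function using (_∘_)
open import Function.Bundles using (Bijection; mk⇔)
open import Level using (0ℓ)
open import Relation.Binary.Definitions using (DecidableEquality)
open import Relation.Binary.PropositionalEquality using (refl; sym; trans; cong; cong₂; subst; subst₂; setoid; module ≡-Reasoning)
import Relation.Binary.Reasoning.Setoid
open import Relation.Nullary using (¬_; Dec; yes; no; does; contradiction)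
open import Relation.Nullary.Decidable using (¬?; _⊎-dec_; toSum; map′; decidable-stable)
open import Relation.Unary using (Decidable)

-- Counting in duplicate-free lists.

module _ {A : Set} where

  -- Induction on `xs`: the head is cut out of `ys` at one occurrence, and the later entries, all
  -- different from it, survive in `us ++ vs`.
  unique-⊆⇒length≤ : {xs ys : List A} → Unique xs → (∀ {x} → x ∈ xs → x ∈ ys) → length xs ≤ length ys
  unique-⊆⇒length≤ {[]} _ _ = z≤n
  unique-⊆⇒length≤ {x ∷ xs} u@(_ ∷ uxs) sub with ∈-∃++ (sub (here refl))
  ... | us , vs , refl = subst (suc (length xs) ≤_) (sym len) (s≤s (unique-⊆⇒length≤ uxs sub′))
    where
    len : length (us ++ x ∷ vs) ≡ suc (length (us ++ vs))
    len = trans (length-++ us) (trans (ℕₚ.+-suc _ _) (cong suc (sym (length-++ us))))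
    sub′ : ∀ {z} → z ∈ xs → z ∈ us ++ vs
    sub′ z∈xs with ∈-++⁻ us (sub (there z∈xs))
    ... | inj₁ z∈us = ∈-++⁺ˡ z∈us
    ... | inj₂ (here refl) = contradiction z∈xs (Unique[x∷xs]⇒x∉xs u)
    ... | inj₂ (there z∈vs) = ∈-++⁺ʳ us z∈vs

  unique-⊆⊇⇒length≡ : {xs ys : List A} → Unique xs → Unique ys →
    (∀ {x} → x ∈ xs → x ∈ ys) → (∀ {x} → x ∈ ys → x ∈ xs) → length xs ≡ length ys
  unique-⊆⊇⇒length≡ u v p q = ℕₚ.≤-antisym (unique-⊆⇒length≤ u p) (unique-⊆⇒length≤ v q)

  -- A missing `y` could be put in front of `xs`, giving a duplicate-free list inside `ys` that is
  -- longer than `ys`.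
  unique-⊆-length≥⇒⊇ : DecidableEquality A → {xs ys : List A} → Unique xs → (∀ {x} → x ∈ xs → x ∈ ys) →
    length ys ≤ length xs → ∀ {y} → y ∈ ys → y ∈ xs
  unique-⊆-length≥⇒⊇ _≟_ {xs} {ys} u sub le {y} y∈ys with y ∈? xs
    where open Data.List.Membership.DecPropositional _≟_ using (_∈?_)
  ... | yes y∈xs = y∈xs
  ... | no y∉xs = contradiction (ℕₚ.≤-trans (unique-⊆⇒length≤ (¬Any⇒All¬ _ y∉xs ∷ u) sub′) le) ℕₚ.1+n≰n
    where
    sub′ : ∀ {x} → x ∈ y ∷ xs → x ∈ ys
    sub′ (here refl) = y∈ys
    sub′ (there x∈xs) = sub x∈xs

  module _ {P : A → Set} (P? : Decidable P) where

    length-filter-¬ : ∀ xs → length xs ≡ length (filter P? xs) ℕ.+ length (filter (¬? ∘ P?) xs)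
    length-filter-¬ [] = refl
    length-filter-¬ (x ∷ xs) with P? x
    ... | yes _ = cong suc (length-filter-¬ xs)
    ... | no _ = trans (cong suc (length-filter-¬ xs)) (sym (ℕₚ.+-suc _ _))

    filter-filter-⊆ : {Q : A → Set} (Q? : Decidable Q) → ∀ xs → (∀ {x} → P x → Q x) →
      filter P? (filter Q? xs) ≡ filter P? xs
    filter-filter-⊆ Q? [] P⊆Q = refl
    filter-filter-⊆ Q? (x ∷ xs) P⊆Q with Q? x
    ... | no ¬q = trans (filter-filter-⊆ Q? xs P⊆Q) (sym (filter-reject P? (¬q ∘ P⊆Q)))
    ... | yes _ with P? x
    ...   | yes _ = cong (x ∷_) (filter-filter-⊆ Q? xs P⊆Q)
    ...   | no _ = filter-filter-⊆ Q? xs P⊆Q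

  equal-classes⇒∣ : {R : A → A → Set} (R? : ∀ x → Decidable (R x)) →
    (∀ x → R x x) → (∀ {x y} → R x y → R y x) → (∀ {x y z} → R x y → R y z → R x z) →
    ∀ o xs → (∀ {x} → x ∈ xs → length (filter (R? x) xs) ≡ o) → o ∣ length xs
  equal-classes⇒∣ {R} R? R-refl R-sym R-trans o xs = go (length xs) xs ℕₚ.≤-refl
    where
    -- The class of the head is removed at each turn. `n` bounds the length and carries the
    -- recursion, because the filtered remainder is not a structural subterm.
    go : ∀ n xs → length xs ≤ n → (∀ {x} → x ∈ xs → length (filter (R? x) xs) ≡ o) → o ∣ length xs
    go n [] _ _ = o ∣0
    go (suc n) (x ∷ xs) (s≤s le) size =
      subst (o ∣_) (sym (trans (length-filter-¬ (R? x) (x ∷ xs)) (cong (ℕ._+ length rest) (size (here refl)))))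
        (∣m∣n⇒∣m+n ∣-refl (go n rest rest≤n size′))
      where
      rest : List A
      rest = filter (¬? ∘ R? x) (x ∷ xs)
      rest≤n : length rest ≤ n
      rest≤n = ℕₚ.≤-trans
        (ℕₚ.≤-trans (ℕₚ.≤-reflexive (cong length (filter-reject (¬? ∘ R? x) (λ ¬r → ¬r (R-refl x)))))
          (length-filter (¬? ∘ R? x) xs)) le
      size′ : ∀ {z} → z ∈ rest → length (filter (R? z) rest) ≡ o
      size′ {z} z∈ with ∈-filter⁻ (¬? ∘ R? x) {xs = x ∷ xs} z∈
      ... | z∈xs , ¬Rxz = trans
        (cong length (filter-filter-⊆ (R? z) (¬? ∘ R? x) (x ∷ xs) (λ Rzy Rxy → ¬Rxz (R-trans Rxy (R-sym Rzy)))))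
        (size z∈xs)

  -- The fibre over the head of `ys` is removed; as `ys` has no repetitions, the fibres over its
  -- other entries stay intact.
  equal-fibres⇒length : {B : Set} (_≟_ : DecidableEquality B) (g : A → B) → ∀ m ys xs → Unique ys →
    (∀ {x} → x ∈ xs → g x ∈ ys) → (∀ {y} → y ∈ ys → length (filter (λ x → g x ≟ y) xs) ≡ m) →
    length xs ≡ length ys ℕ.* m
  equal-fibres⇒length _≟_ g m [] [] _ _ _ = refl
  equal-fibres⇒length _≟_ g m [] (x ∷ xs) _ into _ = contradiction (into (here refl)) λ ()
  equal-fibres⇒length _≟_ g m (y ∷ ys) xs u@(_ ∷ uys) into size =
    trans (length-filter-¬ (λ x → g x ≟ y) xs)
      (cong₂ ℕ._+_ (size (here refl)) (equal-fibres⇒length _≟_ g m ys rest uys into′ size′))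
    where
    rest : List A
    rest = filter (λ x → ¬? (g x ≟ y)) xs
    into′ : ∀ {x} → x ∈ rest → g x ∈ ys
    into′ x∈ with ∈-filter⁻ (λ x → ¬? (g x ≟ y)) {xs = xs} x∈
    ... | x∈xs , gx≢y with into x∈xs
    ...   | here gx≡y = contradiction gx≡y gx≢y
    ...   | there gx∈ys = gx∈ys
    size′ : ∀ {z} → z ∈ ys → length (filter (λ x → g x ≟ z) rest) ≡ m
    size′ {z} z∈ys = trans
      (cong length (filter-filter-⊆ (λ x → g x ≟ z) (λ x → ¬? (g x ≟ y)) xs
        (λ gx≡z gx≡y → Unique[x∷xs]⇒x∉xs u (subst (_∈ ys) (trans (sym gx≡z) gx≡y) z∈ys))))
      (size (there z∈ys))

  -- The pairs `x`, `τ x` are the classes of an equivalence relation, and freeness gives each of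
  -- them exactly two members.
  free-involution⇒even : DecidableEquality A → (τ : A → A) → (∀ x → τ (τ x) ≡ x) →
    ∀ {xs} → Unique xs → (∀ {x} → x ∈ xs → τ x ∈ xs) → (∀ {x} → x ∈ xs → τ x ≢ x) → 2 ∣ length xs
  free-involution⇒even _≟_ τ ττ {xs} u closed free = equal-classes⇒∣ R? (λ _ → inj₁ refl) R-sym R-trans 2 xs size
    where
    R : A → A → Set
    R x y = y ≡ x ⊎ y ≡ τ x
    R? : ∀ x → Decidable (R x)
    R? x y = (y ≟ x) ⊎-dec (y ≟ τ x)
    R-sym : ∀ {x y} → R x y → R y x
    R-sym (inj₁ refl) = inj₁ refl
    R-sym (inj₂ refl) = inj₂ (sym (ττ _))
    R-trans : ∀ {x y z} → R x y → R y z → R x z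
    R-trans (inj₁ refl) r = r
    R-trans (inj₂ refl) (inj₁ refl) = inj₂ refl
    R-trans (inj₂ refl) (inj₂ refl) = inj₁ (ττ _)
    size : ∀ {x} → x ∈ xs → length (filter (R? x) xs) ≡ 2
    size {x} x∈ = unique-⊆⊇⇒length≡ (filter⁺ (R? x) u) (((free x∈ ∘ sym) ∷ []) ∷ [] ∷ []) to from
      where
      to : ∀ {y} → y ∈ filter (R? x) xs → y ∈ x ∷ τ x ∷ []
      to y∈ with proj₂ (∈-filter⁻ (R? x) {xs = xs} y∈)
      ... | inj₁ e = here e
      ... | inj₂ e = there (here e)
      from : ∀ {y} → y ∈ x ∷ τ x ∷ [] → y ∈ filter (R? x) xs
      from (here refl) = ∈-filter⁺ (R? x) x∈ (inj₁ refl)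
      from (there (here refl)) = ∈-filter⁺ (R? x) (closed x∈) (inj₂ refl)

-- Ring solver with integer coefficients.

-- The standard ring solvers cannot decide 1 - 1 = 0 over an abstract field, so coefficients are taken in ℤ.
module IntegerRingSolver (F : FiniteField) where
  open FiniteField F

  commutativeRing : CommutativeRing _ _
  commutativeRing = record { isCommutativeRing = isCommutativeRing }

  private
    open CommutativeRing commutativeRing
      using (ring; semiring; +-abelianGroup; +-assoc; +-comm; +-identityˡ; +-identityʳ; -‿inverseʳ)
    open Algebra.Properties.Ring ring using (-0#≈0#; -‿distribˡ-*; -‿distribʳ-*; -‿involutive)
    open Algebra.Properties.AbelianGroup +-abelianGroup using (⁻¹-∙-comm)
    open Algebra.Properties.Semiring.Mult.TCOptimised semiring
      using (×-homo-+; ×1-homo-*; 1+×) renaming (_×_ to _×ₙ_)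
    open ≡-Reasoning

    nat : ℕ → Carrier
    nat n = n ×ₙ 1#

    ⟦_⟧ : ℤ → Carrier
    ⟦ + n ⟧ = nat n
    ⟦ -[1+ n ] ⟧ = - nat (suc n)

    ⊖-homo : ∀ m n → ⟦ m ℤ.⊖ n ⟧ ≡ nat m - nat n
    ⊖-homo zero zero = sym (-‿inverseʳ 0#)
    ⊖-homo (suc m) zero = sym (trans (cong (λ z → nat (suc m) + z) -0#≈0#) (+-identityʳ _))
    ⊖-homo zero (suc n) = sym (+-identityˡ _)
    ⊖-homo (suc m) (suc n) = begin
      ⟦ suc m ℤ.⊖ suc n ⟧              ≡⟨ cong ⟦_⟧ (ℤₚ.[1+m]⊖[1+n]≡m⊖n m n) ⟩
      ⟦ m ℤ.⊖ n ⟧                      ≡⟨ ⊖-homo m n ⟩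
      nat m - nat n                    ≡⟨ sym (+-identityˡ _) ⟩
      0# + (nat m - nat n)             ≡⟨ cong (_+ (nat m - nat n)) (sym (-‿inverseʳ 1#)) ⟩
      (1# - 1#) + (nat m - nat n)      ≡⟨ +-assoc _ _ _ ⟩
      1# + (- 1# + (nat m - nat n))    ≡⟨ cong (λ z → 1# + z) (trans (sym (+-assoc _ _ _)) (trans (cong (_- nat n) (+-comm _ _)) (+-assoc _ _ _))) ⟩
      1# + (nat m + (- 1# - nat n))    ≡⟨ sym (+-assoc _ _ _) ⟩
      (1# + nat m) + (- 1# - nat n)    ≡⟨ cong₂ _+_ (sym (1+× m 1#)) (trans (⁻¹-∙-comm _ _) (cong -_ (sym (1+× n 1#)))) ⟩
      nat (suc m) - nat (suc n)        ∎

    +-homo : ∀ i j → ⟦ i ℤ.+ j ⟧ ≡ ⟦ i ⟧ + ⟦ j ⟧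
    +-homo (+ m) (+ n) = ×-homo-+ 1# m n
    +-homo (+ m) -[1+ n ] = ⊖-homo m (suc n)
    +-homo -[1+ m ] (+ n) = trans (⊖-homo n (suc m)) (+-comm _ _)
    +-homo -[1+ m ] -[1+ n ] = begin
      - nat (suc (suc (m ℕ.+ n)))      ≡⟨ cong (λ k → - nat (suc k)) (sym (ℕₚ.+-suc m n)) ⟩
      - nat (suc m ℕ.+ suc n)          ≡⟨ cong -_ (×-homo-+ 1# (suc m) (suc n)) ⟩
      - (nat (suc m) + nat (suc n))    ≡⟨ sym (⁻¹-∙-comm _ _) ⟩
      - nat (suc m) - nat (suc n)      ∎

    -‿homo : ∀ i → ⟦ ℤ.- i ⟧ ≡ - ⟦ i ⟧
    -‿homo (+ zero) = sym -0#≈0#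
    -‿homo (+ suc n) = refl
    -‿homo -[1+ n ] = sym (-‿involutive _)

    -◃-homo : ∀ n → ⟦ Sign.- ℤ.◃ n ⟧ ≡ - nat n
    -◃-homo zero = sym -0#≈0#
    -◃-homo (suc n) = refl

    +◃-homo : ∀ n → ⟦ Sign.+ ℤ.◃ n ⟧ ≡ nat n
    +◃-homo zero = refl
    +◃-homo (suc n) = refl

    *-homo : ∀ i j → ⟦ i ℤ.* j ⟧ ≡ ⟦ i ⟧ * ⟦ j ⟧
    *-homo (+ m) (+ n) = trans (+◃-homo (m ℕ.* n)) (×1-homo-* m n)
    *-homo (+ m) -[1+ n ] =
      trans (-◃-homo (m ℕ.* suc n)) (trans (cong -_ (×1-homo-* m (suc n))) (-‿distribʳ-* _ _))
    *-homo -[1+ m ] (+ n) =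
      trans (-◃-homo (suc m ℕ.* n)) (trans (cong -_ (×1-homo-* (suc m) n)) (-‿distribˡ-* _ _))
    *-homo -[1+ m ] -[1+ n ] = begin
      nat (suc m ℕ.* suc n)            ≡⟨ ×1-homo-* (suc m) (suc n) ⟩
      nat (suc m) * nat (suc n)        ≡⟨ sym (-‿involutive _) ⟩
      - - (nat (suc m) * nat (suc n))  ≡⟨ cong -_ (-‿distribʳ-* _ _) ⟩
      - (nat (suc m) * - nat (suc n))  ≡⟨ -‿distribˡ-* _ _ ⟩
      - nat (suc m) * - nat (suc n)    ∎

    morphism : CommutativeRing.rawRing ℤₚ.+-*-commutativeRing
      -Raw-AlmostCommutative⟶ fromCommutativeRing commutativeRing
    morphism = record
      { ⟦_⟧ = ⟦_⟧ ; +-homo = +-homo ; *-homo = *-homo ; -‿homo = -‿homo ; 0-homo = refl ; 1-homo = refl }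

    coefficient≟ : ∀ i j → Maybe (⟦ i ⟧ ≡ ⟦ j ⟧)
    coefficient≟ i j with i ℤ.≟ j
    ... | yes i≡j = just (cong ⟦_⟧ i≡j)
    ... | no _ = nothing

  open Algebra.Solver.Ring _ _ morphism coefficient≟ public
    using (Polynomial; solve; _:=_; _:+_; _:*_; _:-_; :-_; con)

  one : ∀ {n} → Polynomial n
  one = con 1ℤ

-- Field arithmetic, squares and the quadratic character.

module FieldProperties (F : FiniteField) where
  open FiniteField F
  open IntegerRingSolver F public
  open CommutativeRing commutativeRing public using
    ( *-comm; *-assoc; +-comm; +-assoc; *-identityˡ; *-identityʳ; +-identityˡ; +-identityʳ
    ; zeroˡ; zeroʳ; -‿inverseʳ )

  infix 9 _⁻¹

  x-y≡0⇒x≡y : ∀ {x y} → x - y ≡ 0# → x ≡ y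
  x-y≡0⇒x≡y {x} {y} e = trans (solve 2 (λ x y → x := (x :- y) :+ y) refl x y) (trans (cong (_+ y) e) (+-identityˡ y))

  x≡y⇒x-y≡0 : ∀ {x y} → x ≡ y → x - y ≡ 0#
  x≡y⇒x-y≡0 refl = -‿inverseʳ _

  -- The format in which equations are derived from hypotheses: the difference of the sides of the
  -- goal is a multiple of the difference of the sides of the hypothesis, an identity left to the
  -- ring solver. `multiple₂` combines two hypotheses.
  multiple : ∀ {p q u v} k → p ≡ q → u - v ≡ k * (p - q) → u ≡ v
  multiple k p≡q e = x-y≡0⇒x≡y (trans e (trans (cong (k *_) (x≡y⇒x-y≡0 p≡q)) (zeroʳ k)))

  multiple₂ : ∀ {p q r s u v} k l → p ≡ q → r ≡ s → u - v ≡ k * (p - q) + l * (r - s) → u ≡ v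
  multiple₂ k l p≡q r≡s e = x-y≡0⇒x≡y (trans e (trans
    (cong₂ _+_ (trans (cong (k *_) (x≡y⇒x-y≡0 p≡q)) (zeroʳ k)) (trans (cong (l *_) (x≡y⇒x-y≡0 r≡s)) (zeroʳ l)))
    (+-identityˡ 0#)))

  -- The value `0#` at `0#` makes this an involution of the whole field, the form that
  -- `free-involution⇒even` asks for.
  _⁻¹ : Carrier → Carrier
  x ⁻¹ with x ≟ 0#
  ... | yes _ = 0#
  ... | no x≢0 = proj₁ (inverse x x≢0)

  *-inverseʳ : ∀ {x} → x ≢ 0# → x * x ⁻¹ ≡ 1#
  *-inverseʳ {x} x≢0 with x ≟ 0#
  ... | yes x≡0 = contradiction x≡0 x≢0
  ... | no x≢0 = proj₂ (inverse x x≢0)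

  *-inverseˡ : ∀ {x} → x ≢ 0# → x ⁻¹ * x ≡ 1#
  *-inverseˡ {x} x≢0 = trans (*-comm (x ⁻¹) x) (*-inverseʳ x≢0)

  0⁻¹ : 0# ⁻¹ ≡ 0#
  0⁻¹ with 0# ≟ 0#
  ... | yes _ = refl
  ... | no 0≢0 = contradiction refl 0≢0

  *-cancelˡ : ∀ {x y z} → x ≢ 0# → x * y ≡ x * z → y ≡ z
  *-cancelˡ {x} {y} {z} x≢0 e = multiple₂ (x ⁻¹) (z - y) e (*-inverseʳ x≢0)
    (solve 4 (λ x y z i → y :- z := i :* (x :* y :- x :* z) :+ (z :- y) :* (x :* i :- one)) refl x y z (x ⁻¹))

  *-cancelʳ : ∀ {x y z} → x ≢ 0# → y * x ≡ z * x → y ≡ z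
  *-cancelʳ {x} x≢0 e = *-cancelˡ x≢0 (trans (*-comm x _) (trans e (*-comm _ x)))

  xy≡0⇒x≡0⊎y≡0 : ∀ {x y} → x * y ≡ 0# → x ≡ 0# ⊎ y ≡ 0#
  xy≡0⇒x≡0⊎y≡0 {x} {y} e with x ≟ 0#
  ... | yes x≡0 = inj₁ x≡0
  ... | no x≢0 = inj₂ (*-cancelˡ x≢0 (trans e (sym (zeroʳ x))))

  *-nonzero : ∀ {x y} → x ≢ 0# → y ≢ 0# → x * y ≢ 0#
  *-nonzero x≢0 y≢0 e with xy≡0⇒x≡0⊎y≡0 e
  ... | inj₁ x≡0 = x≢0 x≡0
  ... | inj₂ y≡0 = y≢0 y≡0

  ⁻¹-nonzero : ∀ {x} → x ≢ 0# → x ⁻¹ ≢ 0#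
  ⁻¹-nonzero {x} x≢0 e = 0≢1 (trans (sym (zeroʳ x)) (trans (cong (x *_) (sym e)) (*-inverseʳ x≢0)))

  ⁻¹-involutive : ∀ x → x ⁻¹ ⁻¹ ≡ x
  ⁻¹-involutive x with toSum (x ≟ 0#)
  ... | inj₁ refl = trans (cong _⁻¹ 0⁻¹) 0⁻¹
  ... | inj₂ x≢0 = *-cancelˡ (⁻¹-nonzero x≢0)
    (trans (*-inverseʳ (⁻¹-nonzero x≢0)) (sym (*-inverseˡ x≢0)))

  1-[1-x] : ∀ x → x ≡ 1# - (1# - x)
  1-[1-x] = solve 1 (λ x → x := one :- (one :- x)) refl

  1≢0 : 1# ≢ 0#
  1≢0 = 0≢1 ∘ sym

  -- Zero counts as a square, in agreement with the test `χ (y - x) ≥ 0` that selects `a` in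
  -- `quadOp`.
  Square : Carrier → Set
  Square x = ∃ λ y → y * y ≡ x

  square? : Decidable Square
  square? x = map′ satisfied (λ (y , e) → lose (complete y) e) (any? (λ y → y * y ≟ x) elements)

  χ-zero : χ 0# ≡ 0ℤ
  χ-zero with 0# ≟ 0#
  ... | yes _ = refl
  ... | no 0≢0 = contradiction refl 0≢0

  χ-square : ∀ {x} → x ≢ 0# → Square x → χ x ≡ 1ℤ
  χ-square {x} x≢0 (y , e) with x ≟ 0#
  ... | yes x≡0 = contradiction x≡0 x≢0
  ... | no _ with any? (λ y → y * y ≟ x) elements
  ...   | yes _ = refl
  ...   | no ¬sq = contradiction (lose (complete y) e) ¬sq

  0-square : Square 0#
  0-square = 0# , zeroˡ 0#

  1-square : Square 1#
  1-square = 1# , *-identityˡ 1#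

  ¬square⇒≢0 : ∀ {x} → ¬ Square x → x ≢ 0#
  ¬square⇒≢0 ¬sq refl = ¬sq 0-square

  χ-nonsquare : ∀ {x} → ¬ Square x → χ x ≡ -1ℤ
  χ-nonsquare {x} ¬sq with x ≟ 0#
  ... | yes x≡0 = contradiction x≡0 (¬square⇒≢0 ¬sq)
  ... | no _ with any? (λ y → y * y ≟ x) elements
  ...   | yes sq = contradiction (satisfied sq) ¬sq
  ...   | no _ = refl

  χ≢0⇒≢0 : ∀ {x} → χ x ≢ 0ℤ → x ≢ 0#
  χ≢0⇒≢0 χ≢0 refl = χ≢0 χ-zero

  χ≡1⇒square : ∀ {x} → χ x ≡ 1ℤ → Square x
  χ≡1⇒square {x} e with square? x
  ... | yes sq = sq
  ... | no ¬sq with () ← trans (sym e) (χ-nonsquare ¬sq)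

  χ≡-1⇒nonsquare : ∀ {x} → χ x ≡ -1ℤ → ¬ Square x
  χ≡-1⇒nonsquare {x} e sq with toSum (x ≟ 0#)
  ... | inj₁ refl with () ← trans (sym e) χ-zero
  ... | inj₂ x≢0 with () ← trans (sym e) (χ-square x≢0 sq)

  *-square : ∀ {x y} → Square x → Square y → Square (x * y)
  *-square (u , refl) (v , refl) = u * v , solve 2 (λ u v → u :* v :* (u :* v) := u :* u :* (v :* v)) refl u v

  *-square-cancel : ∀ {x y} → x ≢ 0# → Square x → Square (x * y) → Square y
  -- A root of `y` is `w / u`; since `u * u ≡ x`, it can be written `w * x ⁻¹ * u`, with only `x`
  -- inverted.
  *-square-cancel {x} {y} x≢0 (u , e) (w , e′) = w * x ⁻¹ * u , (begin
    w * x ⁻¹ * u * (w * x ⁻¹ * u)      ≡⟨ solve 3 (λ w i u → w :* i :* u :* (w :* i :* u) := w :* w :* (i :* i) :* (u :* u)) refl w (x ⁻¹) u ⟩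
    w * w * (x ⁻¹ * x ⁻¹) * (u * u)    ≡⟨ cong₂ (λ s t → s * (x ⁻¹ * x ⁻¹) * t) e′ e ⟩
    x * y * (x ⁻¹ * x ⁻¹) * x          ≡⟨ multiple (y * (x * x ⁻¹ + 1#)) (*-inverseʳ x≢0)
      (solve 3 (λ x y i → x :* y :* (i :* i) :* x :- y := y :* (x :* i :+ one) :* (x :* i :- one)) refl x y (x ⁻¹)) ⟩
    y                                  ∎)
    where open ≡-Reasoning

  square*nonsquare : ∀ {x y} → x ≢ 0# → Square x → ¬ Square y → ¬ Square (x * y)
  square*nonsquare x≢0 sq ¬sq = ¬sq ∘ *-square-cancel x≢0 sq

  ⁻¹-square : ∀ {x} → Square x → Square (x ⁻¹)
  ⁻¹-square {x} sq with toSum (x ≟ 0#)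
  ... | inj₁ refl = subst Square (sym 0⁻¹) 0-square
  ... | inj₂ x≢0 = *-square-cancel x≢0 sq (subst Square (sym (*-inverseʳ x≢0)) 1-square)

  ⁻¹-nonsquare : ∀ {x} → ¬ Square x → ¬ Square (x ⁻¹)
  ⁻¹-nonsquare {x} ¬sq sq = ¬sq (subst Square (⁻¹-involutive x) (⁻¹-square sq))

  x²≡y²⇒x≡±y : ∀ {x y} → x * x ≡ y * y → x ≡ y ⊎ x ≡ - y
  x²≡y²⇒x≡±y {x} {y} e = Sum.map x-y≡0⇒x≡y
    (λ e′ → multiple 1# e′ (solve 2 (λ x y → x :- (:- y) := one :* (x :+ y :- con 0ℤ)) refl x y))
    (xy≡0⇒x≡0⊎y≡0 (trans (solve 2 (λ x y → (x :- y) :* (x :+ y) := x :* x :- y :* y) refl x y) (x≡y⇒x-y≡0 e)))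

-- Squares and nonsquares in a field of odd order.

module OddField (F : FiniteField) (odd : FiniteField.order F % 2 ≡ 1) where
  open FiniteField F
  open FieldProperties F public

  -- If 2 were 0, adding 1 would be an involution without fixed points, and the order would be even.
  2≢0 : 1# + 1# ≢ 0#
  2≢0 2≡0 = contradiction (trans (sym odd) (n∣m⇒m%n≡0 order 2
    (free-involution⇒even _≟_ (_+ 1#) inv unique (λ _ → complete _) (λ _ → free)))) λ ()
    where
    inv : ∀ x → x + 1# + 1# ≡ x
    inv x = multiple 1# 2≡0 (solve 1 (λ x → x :+ one :+ one :- x := one :* (one :+ one :- con 0ℤ)) refl x)
    free : ∀ {x} → x + 1# ≢ x
    free {x} e = 1≢0 (multiple 1# e (solve 1 (λ x → one :- con 0ℤ := one :* (x :+ one :- x)) refl x))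

  x≢0⇒-x≢x : ∀ {x} → x ≢ 0# → - x ≢ x
  x≢0⇒-x≢x {x} x≢0 e = *-nonzero 2≢0 x≢0 (multiple (- 1#) e
    (solve 1 (λ x → (one :+ one) :* x :- con 0ℤ := :- one :* (:- x :- x)) refl x))

  nonzeros squares nonsquares : List Carrier
  nonzeros = filter (λ x → ¬? (x ≟ 0#)) elements
  squares = filter square? nonzeros
  nonsquares = filter (¬? ∘ square?) nonzeros

  nonzeros-unique : Unique nonzeros
  nonzeros-unique = filter⁺ _ unique

  squares-unique : Unique squares
  squares-unique = filter⁺ _ nonzeros-unique

  ∈-nonzeros⁺ : ∀ {x} → x ≢ 0# → x ∈ nonzeros
  ∈-nonzeros⁺ = ∈-filter⁺ (λ x → ¬? (x ≟ 0#)) (complete _)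

  ∈-nonzeros⁻ : ∀ {x} → x ∈ nonzeros → x ≢ 0#
  ∈-nonzeros⁻ = proj₂ ∘ ∈-filter⁻ (λ x → ¬? (x ≟ 0#)) {xs = elements}

  ∈-squares⁺ : ∀ {x} → x ≢ 0# → Square x → x ∈ squares
  ∈-squares⁺ x≢0 = ∈-filter⁺ square? (∈-nonzeros⁺ x≢0)

  ∈-squares⁻ : ∀ {x} → x ∈ squares → x ≢ 0# × Square x
  ∈-squares⁻ x∈ with ∈-filter⁻ square? {xs = nonzeros} x∈
  ... | x∈nz , sq = ∈-nonzeros⁻ x∈nz , sq

  ∈-nonsquares⁺ : ∀ {x} → ¬ Square x → x ∈ nonsquares
  ∈-nonsquares⁺ ¬sq = ∈-filter⁺ (¬? ∘ square?) (∈-nonzeros⁺ (¬square⇒≢0 ¬sq)) ¬sq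

  ∈-nonsquares⁻ : ∀ {x} → x ∈ nonsquares → ¬ Square x
  ∈-nonsquares⁻ = proj₂ ∘ ∈-filter⁻ (¬? ∘ square?) {xs = nonzeros}

  order≡1+∣nonzeros∣ : order ≡ suc (length nonzeros)
  order≡1+∣nonzeros∣ = trans (length-filter-¬ (_≟ 0#) elements) (cong (ℕ._+ length nonzeros)
    (unique-⊆⊇⇒length≡ (filter⁺ (_≟ 0#) unique) ([] ∷ []) (here ∘ proj₂ ∘ ∈-filter⁻ (_≟ 0#) {xs = elements})
      (λ { (here refl) → ∈-filter⁺ (_≟ 0#) (complete 0#) refl })))

  -- Squaring maps the nonzero elements onto the nonzero squares, and its fibre over `r * r` is `r`,
  -- `- r`.
  ∣nonzeros∣≡2∣squares∣ : length nonzeros ≡ length squares ℕ.* 2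
  ∣nonzeros∣≡2∣squares∣ = equal-fibres⇒length _≟_ (λ x → x * x) 2 squares nonzeros squares-unique
    (λ x∈ → let x≢0 = ∈-nonzeros⁻ x∈ in ∈-squares⁺ (*-nonzero x≢0 x≢0) (_ , refl)) fibre
    where
    fibre : ∀ {y} → y ∈ squares → length (filter (λ x → x * x ≟ y) nonzeros) ≡ 2
    fibre {y} y∈ with ∈-squares⁻ y∈
    ... | y≢0 , (r , refl) = unique-⊆⊇⇒length≡ (filter⁺ _ nonzeros-unique)
      (((x≢0⇒-x≢x r≢0 ∘ sym) ∷ []) ∷ [] ∷ []) to from
      where
      r≢0 : r ≢ 0#
      r≢0 refl = y≢0 (zeroˡ 0#)
      to : ∀ {x} → x ∈ filter (λ x → x * x ≟ r * r) nonzeros → x ∈ r ∷ - r ∷ []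
      to x∈ = Sum.[ here , (λ e → there (here e)) ]′
        (x²≡y²⇒x≡±y (proj₂ (∈-filter⁻ (λ x → x * x ≟ r * r) {xs = nonzeros} x∈)))
      -r*-r : - r * - r ≡ r * r
      -r*-r = solve 1 (λ r → :- r :* :- r := r :* r) refl r
      from : ∀ {x} → x ∈ r ∷ - r ∷ [] → x ∈ filter (λ x → x * x ≟ r * r) nonzeros
      from (here refl) = ∈-filter⁺ (λ x → x * x ≟ r * r) (∈-nonzeros⁺ r≢0) refl
      from (there (here refl)) = ∈-filter⁺ (λ x → x * x ≟ r * r)
        (∈-nonzeros⁺ (λ e → y≢0 (trans (sym -r*-r) (trans (cong (_* - r) e) (zeroˡ _))))) -r*-r

  ∣squares∣≡∣nonsquares∣ : length squares ≡ length nonsquares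
  ∣squares∣≡∣nonsquares∣ = ℕₚ.+-cancelˡ-≡ (length squares) _ _ (begin
    s ℕ.+ s            ≡⟨ cong (s ℕ.+_) (sym (ℕₚ.+-identityʳ s)) ⟩
    2 ℕ.* s            ≡⟨ ℕₚ.*-comm 2 s ⟩
    s ℕ.* 2            ≡⟨ sym ∣nonzeros∣≡2∣squares∣ ⟩
    length nonzeros    ≡⟨ length-filter-¬ square? nonzeros ⟩
    s ℕ.+ length nonsquares ∎)
    where
    open ≡-Reasoning
    s = length squares

  -- Multiplication by `x` maps the nonzero squares injectively into the nonsquares, hence onto
  -- them, both being equally numerous. So `y` is `x * s` for a square `s`, and `x * y` is
  -- `x * x * s`.
  nonsquare*nonsquare : ∀ {x y} → ¬ Square x → ¬ Square y → Square (x * y)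
  nonsquare*nonsquare {x} {y} ¬sx ¬sy = product (∈-map⁻ (x *_) (unique-⊆-length≥⇒⊇ _≟_
      (map⁺ (*-cancelˡ (¬square⇒≢0 ¬sx)) squares-unique) sub len (∈-nonsquares⁺ ¬sy)))
    where
    sub : ∀ {z} → z ∈ map (x *_) squares → z ∈ nonsquares
    sub z∈ with ∈-map⁻ (x *_) z∈
    ... | s , s∈ , refl with ∈-squares⁻ s∈
    ...   | s≢0 , sq = ∈-nonsquares⁺ (square*nonsquare s≢0 sq ¬sx ∘ subst Square (*-comm x s))
    len : length nonsquares ℕ.≤ length (map (x *_) squares)
    len = ℕₚ.≤-reflexive (trans (sym ∣squares∣≡∣nonsquares∣) (sym (length-map (x *_) squares)))
    product : (∃ λ s → s ∈ squares × y ≡ x * s) → Square (x * y)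
    product (s , s∈ , e) = subst Square (trans (*-assoc x x s) (cong (x *_) (sym e)))
      (*-square (x , refl) (proj₂ (∈-squares⁻ s∈)))

  -- There are as many nonsquares as nonzero squares, and `1#` is one of the latter.
  ∃-nonsquare : ∃ λ n → ¬ Square n
  ∃-nonsquare with nonsquares | ∣squares∣≡∣nonsquares∣ | ∈-nonsquares⁻
  ... | n ∷ _ | _ | nonsq = n , nonsq (here refl)
  ... | [] | e | _ = contradiction (subst (1# ∈_) (length≡0 squares e) (∈-squares⁺ 1≢0 1-square)) λ ()
    where
    length≡0 : ∀ (xs : List Carrier) → length xs ≡ 0 → xs ≡ []
    length≡0 [] _ = refl

  order≡1+2∣squares∣ : order ≡ suc (length squares ℕ.* 2)
  order≡1+2∣squares∣ = trans order≡1+∣nonzeros∣ (cong suc ∣nonzeros∣≡2∣squares∣)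

  -- Negation pairs off the nonzero squares.
  -1-square⇒2∣∣squares∣ : Square (- 1#) → 2 ∣ length squares
  -1-square⇒2∣∣squares∣ -1sq =
    free-involution⇒even _≟_ -_ (solve 1 (λ x → :- (:- x) := x) refl) squares-unique closed (x≢0⇒-x≢x ∘ proj₁ ∘ ∈-squares⁻)
    where
    closed : ∀ {x} → x ∈ squares → - x ∈ squares
    closed {x} x∈ with ∈-squares⁻ x∈
    ... | x≢0 , sq = ∈-squares⁺
      (λ e → x≢0 (multiple (- 1#) e (solve 1 (λ x → x :- con 0ℤ := :- one :* (:- x :- con 0ℤ)) refl x)))
      (subst Square (solve 1 (λ x → :- one :* x := :- x) refl x) (*-square -1sq sq))

  squares≢1 : List Carrier
  squares≢1 = filter (λ x → ¬? (x ≟ 1#)) squares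

  ∈-squares≢1⁻ : ∀ {x} → x ∈ squares≢1 → x ≢ 0# × Square x × x ≢ 1#
  ∈-squares≢1⁻ x∈ with ∈-filter⁻ (λ x → ¬? (x ≟ 1#)) {xs = squares} x∈
  ... | x∈sq , x≢1 with ∈-squares⁻ x∈sq
  ...   | x≢0 , sq = x≢0 , sq , x≢1

  ∣squares∣≡1+∣squares≢1∣ : length squares ≡ suc (length squares≢1)
  ∣squares∣≡1+∣squares≢1∣ = trans (length-filter-¬ (_≟ 1#) squares) (cong (ℕ._+ length squares≢1)
    (unique-⊆⊇⇒length≡ (filter⁺ (_≟ 1#) squares-unique) ([] ∷ []) (here ∘ proj₂ ∘ ∈-filter⁻ (_≟ 1#) {xs = squares})
    (λ { (here refl) → ∈-filter⁺ (_≟ 1#) (∈-squares⁺ 1≢0 1-square) refl })))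

  -- Among nonzero elements inversion fixes only 1 and -1, and neither belongs to `squares≢1`.
  -1-nonsquare⇒2∣∣squares≢1∣ : ¬ Square (- 1#) → 2 ∣ length squares≢1
  -1-nonsquare⇒2∣∣squares≢1∣ ¬sq = free-involution⇒even _≟_ _⁻¹ ⁻¹-involutive (filter⁺ _ squares-unique) closed free
    where
    closed : ∀ {x} → x ∈ squares≢1 → x ⁻¹ ∈ squares≢1
    closed {x} x∈ with ∈-squares≢1⁻ x∈
    ... | x≢0 , sq , x≢1 = ∈-filter⁺ (λ x → ¬? (x ≟ 1#)) (∈-squares⁺ (⁻¹-nonzero x≢0) (⁻¹-square sq))
      (λ e → x≢1 (trans (sym (*-identityʳ x)) (trans (cong (x *_) (sym e)) (*-inverseʳ x≢0))))
    free : ∀ {x} → x ∈ squares≢1 → x ⁻¹ ≢ x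
    free {x} x∈ e with ∈-squares≢1⁻ x∈
    ... | x≢0 , sq , x≢1 = Sum.[ x≢1 , (λ x≡-1 → ¬sq (subst Square x≡-1 sq)) ]′
      (x²≡y²⇒x≡±y (trans (cong (x *_) (sym e)) (trans (*-inverseʳ x≢0) (sym (*-identityˡ 1#)))))

  -- The order is `1 + 2s` for `s` nonzero squares: `s = 2k` gives `1 + 4k` here, and `s = 1 + 2k`
  -- gives `3 + 4k` when -1 is a nonsquare.
  -1-square⇒order≡1 : Square (- 1#) → order % 4 ≡ 1
  -1-square⇒order≡1 sq = remainder (-1-square⇒2∣∣squares∣ sq)
    where
    remainder : 2 ∣ length squares → order % 4 ≡ 1
    remainder (divides k e) = trans
      (cong (_% 4) (trans order≡1+2∣squares∣ (cong suc (trans (cong (ℕ._* 2) e) (ℕₚ.*-assoc k 2 2)))))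
      ([m+kn]%n≡m%n 1 k 4)

  -1-nonsquare⇒order≡3 : ¬ Square (- 1#) → order % 4 ≡ 3
  -1-nonsquare⇒order≡3 ¬sq = remainder (-1-nonsquare⇒2∣∣squares≢1∣ ¬sq)
    where
    remainder : 2 ∣ length squares≢1 → order % 4 ≡ 3
    remainder (divides k e) = trans
      (cong (_% 4) (trans order≡1+2∣squares∣ (cong (λ m → suc (m ℕ.* 2)) (trans ∣squares∣≡1+∣squares≢1∣ (cong suc e)))))
      (trans (cong (λ m → (3 ℕ.+ m) % 4) (ℕₚ.*-assoc k 2 2)) ([m+kn]%n≡m%n 3 k 4))

  order≡3⇒-1-nonsquare : order % 4 ≡ 3 → ¬ Square (- 1#)
  order≡3⇒-1-nonsquare e sq = contradiction (trans (sym e) (-1-square⇒order≡1 sq)) λ ()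

-- Existence of the characteristic.

module Characteristic (F : FiniteField) (odd : FiniteField.order F % 2 ≡ 1) where
  open FiniteField F
  open OddField F odd

  ι-+ : ∀ m n → ι (m ℕ.+ n) ≡ ι m + ι n
  ι-+ zero n = sym (+-identityˡ _)
  ι-+ (suc m) n = trans (cong (λ z → 1# + z) (ι-+ m n)) (sym (+-assoc _ _ _))

  ι-repeats : ∃ λ n → 0 ℕ.< n × ι n ≡ 0#
  -- The `order + 1` elements `ι 0`, ..., `ι order` have only `order` possible positions in
  -- `elements`.
  ι-repeats = difference (pigeonhole ℕₚ.≤-refl (λ (i : Fin (suc order)) → Any.index (complete (ι (toℕ i)))))
    where
    difference : (∃ λ (i : Fin (suc order)) → ∃ λ j → toℕ i ℕ.< toℕ j ×
        Any.index (complete (ι (toℕ i))) ≡ Any.index (complete (ι (toℕ j)))) →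
      ∃ λ n → 0 ℕ.< n × ι n ≡ 0#
    difference (i , j , i<j , e) = toℕ j ℕ.∸ toℕ i , ℕₚ.m<n⇒0<n∸m i<j ,
      multiple₂ 1# 1# (trans (sym (ι-+ (toℕ i) _)) (cong ι (ℕₚ.m+[n∸m]≡n (ℕₚ.<⇒≤ i<j)))) (sym ιi≡ιj)
        (solve 3 (λ x y z → z :- con 0ℤ := one :* (x :+ z :- y) :+ one :* (y :- x)) refl (ι (toℕ i)) (ι (toℕ j)) _)
      where
      ιi≡ιj : ι (toℕ i) ≡ ι (toℕ j)
      ιi≡ιj = trans (lookup-index (complete (ι (toℕ i))))
        (trans (cong (lookup elements) e) (sym (lookup-index (complete (ι (toℕ j))))))

  -- Searching upwards makes the first zero found satisfy the minimality clause of
  -- `HasCharacteristic`.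
  characteristic-search : ∀ k → ∃ HasCharacteristic ⊎ (∀ m → 0 ℕ.< m → m ℕ.≤ k → ι m ≢ 0#)
  characteristic-search zero = inj₂ (λ { (suc m) _ () })
  characteristic-search (suc k) with characteristic-search k
  ... | inj₁ found = inj₁ found
  ... | inj₂ none with ι (suc k) ≟ 0#
  ...   | yes e = inj₁ (suc k , s≤s z≤n , e , λ { m 0<m (s≤s m≤k) → none m 0<m m≤k })
  ...   | no ne = inj₂ λ m 0<m m≤1+k → Sum.[ (λ { (s≤s m≤k) → none m 0<m m≤k }) , (λ { refl → ne }) ] (ℕₚ.m≤n⇒m<n∨m≡n m≤1+k)

  characteristic : ∃ HasCharacteristic
  characteristic = search ι-repeats
    where
    search : (∃ λ n → 0 ℕ.< n × ι n ≡ 0#) → ∃ HasCharacteristic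
    search (n , 0<n , e) = Sum.[ (λ found → found) , (λ none → contradiction e (none n 0<n ℕₚ.≤-refl)) ]′ (characteristic-search n)

  characteristic≥3 : HasCharacteristic 3 ⊎ (Σ ℕ λ p → HasCharacteristic p × 3 ℕ.< p)
  characteristic≥3 = cases characteristic
    where
    cases : ∃ HasCharacteristic → HasCharacteristic 3 ⊎ (Σ ℕ λ p → HasCharacteristic p × 3 ℕ.< p)
    cases (0 , () , _)
    cases (1 , _ , e , _) = contradiction (trans (sym (+-identityʳ 1#)) e) 1≢0
    cases (2 , _ , e , _) = contradiction (trans (cong (λ z → 1# + z) (sym (+-identityʳ 1#))) e) 2≢0
    cases (3 , h) = inj₁ h
    cases (p@(suc (suc (suc (suc _)))) , h) = inj₂ (p , h , s≤s (s≤s (s≤s (s≤s z≤n))))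

-- The maps f, their composites, and the opposite of a quadratic quasigroup.

module QuadraticMap (F : FiniteField) (odd : FiniteField.order F % 2 ≡ 1) where
  open FiniteField F
  open OddField F odd public

  f : Carrier → Carrier → Carrier → Carrier
  f a b d = if does (0ℤ ℤ.≤? χ d) then a * d else b * d

  quadOp-f : ∀ a b x y → quadOp a b x y ≡ x + f a b (y - x)
  quadOp-f a b x y with does (0ℤ ℤ.≤? χ (y - x))
  ... | true = refl
  ... | false = refl

  f-square : ∀ {a b d} → Square d → f a b d ≡ a * d
  f-square {d = d} sq with toSum (d ≟ 0#)
  ... | inj₁ refl rewrite χ-zero = refl
  ... | inj₂ d≢0 rewrite χ-square d≢0 sq = refl

  f-nonsquare : ∀ {a b d} → ¬ Square d → f a b d ≡ b * d
  f-nonsquare ¬sq rewrite χ-nonsquare ¬sq = refl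

  f-0 : ∀ {a b} → f a b 0# ≡ 0#
  f-0 = trans (f-square 0-square) (zeroʳ _)

  f-1 : ∀ {a b} → f a b 1# ≡ a
  f-1 = trans (f-square 1-square) (*-identityʳ _)

  f-diagonal : ∀ {a} d → f a a d ≡ a * d
  f-diagonal d with square? d
  ... | yes sq = f-square sq
  ... | no ¬sq = f-nonsquare ¬sq

  f-1-1 : ∀ {c e} → c ≡ 1# → e ≡ 1# → ∀ x → f c e x ≡ x
  f-1-1 refl refl x = trans (f-diagonal x) (*-identityˡ x)

  f-square* : ∀ {a b s} → s ≢ 0# → Square s → ∀ d → f a b (s * d) ≡ s * f a b d
  f-square* {a} {b} {s} s≢0 sq d with square? d
  ... | yes sd = trans (f-square (*-square sq sd))
    (trans (solve 3 (λ a s d → a :* (s :* d) := s :* (a :* d)) refl a s d) (cong (s *_) (sym (f-square sd))))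
  ... | no ¬sd = trans (f-nonsquare (square*nonsquare s≢0 sq ¬sd))
    (trans (solve 3 (λ a s d → a :* (s :* d) := s :* (a :* d)) refl b s d) (cong (s *_) (sym (f-nonsquare ¬sd))))

  f-nonsquare* : ∀ {a b s} → ¬ Square s → ∀ d → f a b (s * d) ≡ s * f b a d
  f-nonsquare* {a} {b} {s} ¬sq d with square? d | toSum (d ≟ 0#)
  -- Zero is treated apart: it is a square that stays a square after multiplication by a nonsquare.
  ... | _ | inj₁ refl = trans (cong (f a b) (zeroʳ s)) (trans f-0 (sym (trans (cong (s *_) f-0) (zeroʳ s))))
  ... | yes sd | inj₂ d≢0 = trans (f-nonsquare (λ sq → square*nonsquare d≢0 sd ¬sq (subst Square (*-comm s d) sq)))
    (trans (solve 3 (λ a s d → a :* (s :* d) := s :* (a :* d)) refl b s d) (cong (s *_) (sym (f-square sd))))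
  ... | no ¬sd | _ = trans (f-square (nonsquare*nonsquare ¬sq ¬sd))
    (trans (solve 3 (λ a s d → a :* (s :* d) := s :* (a :* d)) refl a s d) (cong (s *_) (sym (f-nonsquare ¬sd))))

  -- This is where the parameters `1# - a` and `1# - b` of the opposite quasigroup come from.
  f-complement : ∀ {a b} d → d - f a b d ≡ f (1# - a) (1# - b) d
  f-complement {a} {b} d with square? d
  ... | yes sd = trans (cong (λ z → d - z) (f-square sd))
    (trans (solve 2 (λ a d → d :- a :* d := (one :- a) :* d) refl a d) (sym (f-square sd)))
  ... | no ¬sd = trans (cong (λ z → d - z) (f-nonsquare ¬sd))
    (trans (solve 2 (λ a d → d :- a :* d := (one :- a) :* d) refl b d) (sym (f-nonsquare ¬sd)))

  -- The value at 1 determines the first parameter, the value at a nonsquare the second. An identity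
  -- between maps thus becomes two equations in the field.
  f-injective-parameters : ∀ {a b c e} → (∀ d → f a b d ≡ f c e d) → a ≡ c × b ≡ e
  f-injective-parameters same = trans (sym f-1) (trans (same 1#) f-1) ,
    *-cancelʳ (¬square⇒≢0 ¬sq) (trans (sym (f-nonsquare ¬sq)) (trans (same n) (f-nonsquare ¬sq)))
    where
    n = proj₁ ∃-nonsquare
    ¬sq = proj₂ ∃-nonsquare

  -- The condition `χ a ≡ χ b ≢ 0ℤ` as a case distinction, the one on which composites of the maps f
  -- depend. Nonsquares are nonzero by themselves, since zero is a square.
  data Paired (a b : Carrier) : Set where
    both-square    : a ≢ 0# → b ≢ 0# → Square a → Square b → Paired a b
    both-nonsquare : ¬ Square a → ¬ Square b → Paired a b

  χ≡⇒Paired : ∀ {a b} → χ a ≡ χ b → χ a ≢ 0ℤ → Paired a b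
  χ≡⇒Paired {a} {b} e χa≢0 = cases (square? a) (square? b)
    where
    a≢0 : a ≢ 0#
    a≢0 = χ≢0⇒≢0 χa≢0
    b≢0 : b ≢ 0#
    b≢0 = χ≢0⇒≢0 (χa≢0 ∘ trans e)
    cases : Dec (Square a) → Dec (Square b) → Paired a b
    cases (yes sa) (yes sb) = both-square a≢0 b≢0 sa sb
    cases (no ¬sa) (no ¬sb) = both-nonsquare ¬sa ¬sb
    cases (yes sa) (no ¬sb) = contradiction (trans (sym (χ-square a≢0 sa)) (trans e (χ-nonsquare ¬sb))) λ ()
    cases (no ¬sa) (yes sb) = contradiction (trans (sym (χ-nonsquare ¬sa)) (trans e (χ-square b≢0 sb))) λ ()

  Paired-sym : ∀ {a b} → Paired a b → Paired b a
  Paired-sym (both-square a≢0 b≢0 sa sb) = both-square b≢0 a≢0 sb sa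
  Paired-sym (both-nonsquare ¬sa ¬sb) = both-nonsquare ¬sb ¬sa

  Paired⇒≢0 : ∀ {a b} → Paired a b → a ≢ 0#
  Paired⇒≢0 (both-square a≢0 _ _ _) = a≢0
  Paired⇒≢0 (both-nonsquare ¬sa _) = ¬square⇒≢0 ¬sa

  -- The inner map keeps squares and nonsquares apart, so the parameters multiply branch by branch.
  f∘f-square : ∀ {a b} → a ≢ 0# → b ≢ 0# → Square a → Square b → ∀ c e d → f c e (f a b d) ≡ f (c * a) (e * b) d
  f∘f-square {a} {b} a≢0 b≢0 sa sb c e d with square? d
  ... | yes sd = trans (cong (f c e) (f-square sd)) (trans (f-square (*-square sa sd)) (trans (sym (*-assoc c a d)) (sym (f-square sd))))
  ... | no ¬sd = trans (cong (f c e) (f-nonsquare ¬sd))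
    (trans (f-nonsquare (square*nonsquare b≢0 sb ¬sd)) (trans (sym (*-assoc e b d)) (sym (f-nonsquare ¬sd))))

  -- The inner map exchanges nonzero squares with nonsquares, so each of its parameters meets the
  -- opposite parameter of the outer map.
  f∘f-nonsquare : ∀ {a b} → ¬ Square a → ¬ Square b → ∀ c e d → f c e (f a b d) ≡ f (e * a) (c * b) d
  f∘f-nonsquare {a} {b} ¬sa ¬sb c e d with square? d
  ... | yes sd = trans (cong (f c e) (f-square sd)) (trans (f-nonsquare* ¬sa d)
    (trans (cong (a *_) (f-square sd)) (trans (solve 3 (λ a e d → a :* (e :* d) := e :* a :* d) refl a e d) (sym (f-square sd)))))
  ... | no ¬sd = trans (cong (f c e) (f-nonsquare ¬sd)) (trans (f-nonsquare* ¬sb d)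
    (trans (cong (b *_) (f-nonsquare ¬sd)) (trans (solve 3 (λ a e d → a :* (e :* d) := e :* a :* d) refl b c d) (sym (f-nonsquare ¬sd)))))

  f-inverse : ∀ {a b} → Paired a b → ∃ λ (h : Carrier → Carrier) → (∀ x → h (f a b x) ≡ x) × (∀ x → f a b (h x) ≡ x)
  f-inverse {a} {b} (both-square a≢0 b≢0 sa sb) = f (a ⁻¹) (b ⁻¹) ,
    (λ x → trans (f∘f-square a≢0 b≢0 sa sb _ _ x) (f-1-1 (*-inverseˡ a≢0) (*-inverseˡ b≢0) x)) ,
    (λ x → trans (f∘f-square (⁻¹-nonzero a≢0) (⁻¹-nonzero b≢0) (⁻¹-square sa) (⁻¹-square sb) _ _ x)
      (f-1-1 (*-inverseʳ a≢0) (*-inverseʳ b≢0) x))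
  -- A nonzero square is sent by `f a b` to a nonsquare, where `a` has to be undone; hence `a ⁻¹`
  -- stands in second place.
  f-inverse {a} {b} (both-nonsquare ¬sa ¬sb) = f (b ⁻¹) (a ⁻¹) ,
    (λ x → trans (f∘f-nonsquare ¬sa ¬sb _ _ x) (f-1-1 (*-inverseˡ a≢0) (*-inverseˡ b≢0) x)) ,
    (λ x → trans (f∘f-nonsquare (⁻¹-nonsquare ¬sb) (⁻¹-nonsquare ¬sa) _ _ x)
      (f-1-1 (*-inverseʳ b≢0) (*-inverseʳ a≢0) x))
    where
    a≢0 = ¬square⇒≢0 ¬sa
    b≢0 = ¬square⇒≢0 ¬sb

  f-injective : ∀ {a b} → Paired a b → ∀ {x y} → f a b x ≡ f a b y → x ≡ y
  f-injective p e with f-inverse p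
  ... | h , hf , _ = trans (sym (hf _)) (trans (cong h e) (hf _))

  quadOp-0ˡ : ∀ a b y → quadOp a b 0# y ≡ f a b y
  quadOp-0ˡ a b y = trans (quadOp-f a b 0# y) (trans (+-identityˡ _) (cong (f a b) (solve 1 (λ y → y :- con 0ℤ := y) refl y)))

  quadOp-square* : ∀ a b {s} → s ≢ 0# → Square s → ∀ x y → quadOp a b (s * x) (s * y) ≡ s * quadOp a b x y
  quadOp-square* a b {s} s≢0 sq x y = begin
    quadOp a b (s * x) (s * y)        ≡⟨ quadOp-f a b _ _ ⟩
    s * x + f a b (s * y - s * x)     ≡⟨ cong (λ z → s * x + f a b z) (solve 3 (λ s x y → s :* y :- s :* x := s :* (y :- x)) refl s x y) ⟩
    s * x + f a b (s * (y - x))       ≡⟨ cong (λ z → s * x + z) (f-square* s≢0 sq (y - x)) ⟩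
    s * x + s * f a b (y - x)         ≡⟨ solve 3 (λ s x y → s :* x :+ s :* y := s :* (x :+ y)) refl s x _ ⟩
    s * (x + f a b (y - x))           ≡⟨ cong (s *_) (sym (quadOp-f a b x y)) ⟩
    s * quadOp a b x y                ∎
    where open ≡-Reasoning

  quadOp-+ : ∀ a b x y t → quadOp a b (x + t) (y + t) ≡ quadOp a b x y + t
  quadOp-+ a b x y t = begin
    quadOp a b (x + t) (y + t)               ≡⟨ quadOp-f a b _ _ ⟩
    x + t + f a b (y + t - (x + t))          ≡⟨ cong (λ z → x + t + f a b z) (solve 3 (λ x y t → y :+ t :- (x :+ t) := y :- x) refl x y t) ⟩
    x + t + f a b (y - x)                    ≡⟨ solve 3 (λ x t z → x :+ t :+ z := x :+ z :+ t) refl x t _ ⟩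
    x + f a b (y - x) + t                    ≡⟨ cong (_+ t) (sym (quadOp-f a b x y)) ⟩
    quadOp a b x y + t                       ∎
    where open ≡-Reasoning

  quadOp-diagonal : ∀ a x y → quadOp a a x y ≡ x + a * (y - x)
  quadOp-diagonal a x y = trans (quadOp-f a a x y) (cong (λ z → x + z) (f-diagonal (y - x)))

  quadOp-idempotent : ∀ a b x → quadOp a b x x ≡ x
  quadOp-idempotent a b x = trans (quadOp-f a b x x)
    (trans (cong (λ z → x + f a b z) (-‿inverseʳ x)) (trans (cong (λ z → x + z) f-0) (+-identityʳ x)))

  quadOp-flip-square : Square (- 1#) → ∀ a b x y → quadOp a b y x ≡ quadOp (1# - a) (1# - b) x y
  quadOp-flip-square sq a b x y = begin
    quadOp a b y x                             ≡⟨ quadOp-f a b y x ⟩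
    y + f a b (x - y)                          ≡⟨ cong (λ z → y + f a b z) (solve 2 (λ x y → x :- y := :- one :* (y :- x)) refl x y) ⟩
    y + f a b (- 1# * (y - x))                 ≡⟨ cong (λ z → y + z) (f-square* -1≢0 sq (y - x)) ⟩
    y + - 1# * f a b (y - x)                   ≡⟨ solve 3 (λ x y z → y :+ :- one :* z := x :+ ((y :- x) :- z)) refl x y _ ⟩
    x + ((y - x) - f a b (y - x))              ≡⟨ cong (λ z → x + z) (f-complement (y - x)) ⟩
    x + f (1# - a) (1# - b) (y - x)            ≡⟨ sym (quadOp-f _ _ x y) ⟩
    quadOp (1# - a) (1# - b) x y               ∎
    where
    open ≡-Reasoning
    -1≢0 : - 1# ≢ 0#
    -1≢0 e = 1≢0 (multiple (- 1#) e (solve 0 (one :- con 0ℤ := :- one :* (:- one :- con 0ℤ)) refl))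

  quadOp-flip-nonsquare : ¬ Square (- 1#) → ∀ a b x y → quadOp a b y x ≡ quadOp (1# - b) (1# - a) x y
  quadOp-flip-nonsquare ¬sq a b x y = begin
    quadOp a b y x                             ≡⟨ quadOp-f a b y x ⟩
    y + f a b (x - y)                          ≡⟨ cong (λ z → y + f a b z) (solve 2 (λ x y → x :- y := :- one :* (y :- x)) refl x y) ⟩
    y + f a b (- 1# * (y - x))                 ≡⟨ cong (λ z → y + z) (f-nonsquare* ¬sq (y - x)) ⟩
    y + - 1# * f b a (y - x)                   ≡⟨ solve 3 (λ x y z → y :+ :- one :* z := x :+ ((y :- x) :- z)) refl x y _ ⟩
    x + ((y - x) - f b a (y - x))              ≡⟨ cong (λ z → x + z) (f-complement (y - x)) ⟩
    x + f (1# - b) (1# - a) (y - x)            ≡⟨ sym (quadOp-f _ _ x y) ⟩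
    quadOp (1# - b) (1# - a) x y               ∎
    where open ≡-Reasoning

  quadOp-injectiveʳ : ∀ {a b} → Paired a b → ∀ x {y z} → quadOp a b x y ≡ quadOp a b x z → y ≡ z
  quadOp-injectiveʳ {a} {b} p x {y} {z} e = multiple 1# (f-injective p (multiple 1# (trans (sym (quadOp-f a b x y)) (trans e (quadOp-f a b x z)))
      (solve 3 (λ x u v → u :- v := one :* (x :+ u :- (x :+ v))) refl x _ _)))
    (solve 3 (λ x y z → y :- z := one :* (y :- x :- (z :- x))) refl x y z)

  -- Remembers how the parameters of the opposite arise, so that `c` and `d` can stay abstract until
  -- their values matter.
  data FlipParameters (a b : Carrier) : Carrier → Carrier → Set where
    flip-square    : Square (- 1#) → FlipParameters a b (1# - a) (1# - b)
    flip-nonsquare : ¬ Square (- 1#) → FlipParameters a b (1# - b) (1# - a)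

  -- The opposite of a quadratic quasigroup is again quadratic, which transfers left-handed facts to right-handed ones.
  quadOp-flip : ∀ a b → Paired a b → Paired (1# - a) (1# - b) → ∃ λ c → ∃ λ d →
    FlipParameters a b c d × Paired c d × Paired (1# - c) (1# - d) × (∀ x y → quadOp a b y x ≡ quadOp c d x y)
  quadOp-flip a b p q with square? (- 1#)
  ... | yes sq = _ , _ , flip-square sq , q , subst₂ Paired (1-[1-x] a) (1-[1-x] b) p , quadOp-flip-square sq a b
  ... | no ¬sq = _ , _ , flip-nonsquare ¬sq , Paired-sym q ,
    subst₂ Paired (1-[1-x] b) (1-[1-x] a) (Paired-sym p) , quadOp-flip-nonsquare ¬sq a b

  quadOp-injectiveˡ : ∀ {a b} → Paired a b → Paired (1# - a) (1# - b) → ∀ y {x z} → quadOp a b x y ≡ quadOp a b z y → x ≡ z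
  quadOp-injectiveˡ {a} {b} p q y e with quadOp-flip a b p q
  ... | c , d , _ , p′ , _ , flip = quadOp-injectiveʳ p′ y (trans (sym (flip _ _)) (trans e (flip _ _)))

-- Left and right distributivity, mediality.

module Distributivity (F : FiniteField) (odd : FiniteField.order F % 2 ≡ 1) where
  open FiniteField F
  open QuadraticMap F odd public

  -- Let `T` be the squares with 0. If `T` were closed, the products of `n` with the elements of `T`
  -- would be distinct nonsquares, but `T` has one element more than there are nonsquares.
  ¬squares-closed : ∀ {a b} → Paired a b → Paired (1# - a) (1# - b) →
    ∀ {n} → ¬ Square n → ¬ (∀ {y z} → Square y → Square z → Square (quadOp a b y z))
  ¬squares-closed {a} {b} p q {n} ¬sn closed = ℕₚ.1+n≰n (ℕₚ.≤-trans
    (subst (ℕ._≤ length nonsquares) (length-map (quadOp a b n) T) (unique-⊆⇒length≤ (map⁺ (quadOp-injectiveʳ p n) T-unique) nT⊆N))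
    (ℕₚ.≤-reflexive (sym ∣squares∣≡∣nonsquares∣)))
    where
    T : List Carrier
    T = 0# ∷ squares
    T-unique : Unique T
    T-unique = ¬Any⇒All¬ _ (λ 0∈ → proj₁ (∈-squares⁻ 0∈) refl) ∷ squares-unique
    ∈T⇒square : ∀ {x} → x ∈ T → Square x
    ∈T⇒square (here refl) = 0-square
    ∈T⇒square (there x∈) = proj₂ (∈-squares⁻ x∈)
    square⇒∈T : ∀ {x} → Square x → x ∈ T
    square⇒∈T {x} sq = Sum.[ here , (λ x≢0 → there (∈-squares⁺ x≢0 sq)) ]′ (toSum (x ≟ 0#))
    -- Right translation by `t` is injective and maps `T` into itself, hence onto itself; so the
    -- nonsquare `n` cannot also be sent into `T`.
    nt-nonsquare : ∀ {t} → Square t → ¬ Square (quadOp a b n t)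
    nt-nonsquare {t} st snt = recover (∈-map⁻ (λ u → quadOp a b u t) (unique-⊆-length≥⇒⊇ _≟_
        (map⁺ (quadOp-injectiveˡ p q t) T-unique) Tt⊆T
        (ℕₚ.≤-reflexive (sym (length-map (λ u → quadOp a b u t) T))) (square⇒∈T snt)))
      where
      Tt⊆T : ∀ {z} → z ∈ map (λ u → quadOp a b u t) T → z ∈ T
      Tt⊆T z∈ with ∈-map⁻ (λ u → quadOp a b u t) z∈
      ... | u , u∈ , refl = square⇒∈T (closed (∈T⇒square u∈) st)
      recover : ¬ (∃ λ u → u ∈ T × quadOp a b n t ≡ quadOp a b u t)
      recover (u , u∈ , e) = ¬sn (subst Square (sym (quadOp-injectiveˡ p q t e)) (∈T⇒square u∈))
    nT⊆N : ∀ {z} → z ∈ map (quadOp a b n) T → z ∈ nonsquares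
    nT⊆N z∈ with ∈-map⁻ (quadOp a b n) z∈
    ... | t , t∈ , refl = ∈-nonsquares⁺ (nt-nonsquare (∈T⇒square t∈))

  -- On a nonsquare `w` the value is `b * w`, which differs from `a * w`. Squares can therefore be
  -- recognised by the action of f.
  f-square⇒square : ∀ {a b w} → a ≢ b → f a b w ≡ a * w → Square w
  f-square⇒square {a} {b} {w} a≢b e with square? w
  ... | yes sq = sq
  ... | no ¬sq = contradiction (*-cancelʳ (¬square⇒≢0 ¬sq) (trans (sym e) (f-nonsquare ¬sq))) a≢b

  -- Left translation by 0 is f, so this is the distributive law at `x = 0`.
  f-automorphism : ∀ {a b} → LeftDistributive (quadOp a b) → ∀ y z →
    f a b (quadOp a b y z) ≡ quadOp a b (f a b y) (f a b z)
  f-automorphism {a} {b} ld y z = trans (sym (quadOp-0ˡ a b _))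
    (trans (ld 0# y z) (cong₂ (quadOp a b) (quadOp-0ˡ a b y) (quadOp-0ˡ a b z)))

  -- For squares `y` and `z`, the automorphism f multiplies both by the square `a`, hence also
  -- multiplies their product by `a`; so the product is a square, and the squares would be closed.
  leftDistributive-square : ∀ {a b} → Square a → a ≢ 0# → Paired a b → Paired (1# - a) (1# - b) →
    LeftDistributive (quadOp a b) → ¬ a ≢ b
  leftDistributive-square {a} {b} sa a≢0 p q ld a≢b = ¬squares-closed p q (proj₂ ∃-nonsquare) λ {y} {z} sy sz →
    f-square⇒square a≢b (trans (f-automorphism ld y z)
      (trans (cong₂ (quadOp a b) (f-square sy) (f-square sz)) (quadOp-square* a b a≢0 sa y z)))

  module NonsquareCase {a b} (¬sa : ¬ Square a) (¬sb : ¬ Square b) (q : Paired (1# - a) (1# - b))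
    (ld : LeftDistributive (quadOp a b)) (a≢b : a ≢ b) where

    a-b≢0 : a - b ≢ 0#
    a-b≢0 = a≢b ∘ x-y≡0⇒x≡y

    a≢0 : a ≢ 0#
    a≢0 = ¬square⇒≢0 ¬sa

    -- The automorphism property at the pair 1, `z`: both are multiplied by the nonsquare `a`, and
    -- taking `a` out of f interchanges the parameters.
    automorphism-at-1 : ∀ {z} → Square z → f a b (1# + f a b (z - 1#)) ≡ a + a * f b a (z - 1#)
    automorphism-at-1 {z} sz = begin
      f a b (1# + f a b (z - 1#))            ≡⟨ cong (f a b) (sym (quadOp-f a b 1# z)) ⟩
      f a b (quadOp a b 1# z)                ≡⟨ f-automorphism ld 1# z ⟩
      quadOp a b (f a b 1#) (f a b z)        ≡⟨ cong₂ (quadOp a b) f-1 (f-square sz) ⟩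
      quadOp a b a (a * z)                   ≡⟨ quadOp-f a b a (a * z) ⟩
      a + f a b (a * z - a)                  ≡⟨ cong (λ w → a + f a b w) (solve 2 (λ a z → a :* z :- a := a :* (z :- one)) refl a z) ⟩
      a + f a b (a * (z - 1#))               ≡⟨ cong (λ w → a + w) (f-nonsquare* ¬sa (z - 1#)) ⟩
      a + a * f b a (z - 1#)                 ∎
      where open ≡-Reasoning

    -- With `d = z - 1` a square, `automorphism-at-1` gives `a * (a - b) * d = 0` if `1 + a * d` is
    -- a square, and `a = b` if it is not.
    z-1-nonsquare : ∀ {z} → Square z → z ≢ 1# → ¬ Square (z - 1#)
    z-1-nonsquare {z} sz z≢1 s = by-cases (square? w)
      where
      d = z - 1#
      w = 1# + a * d
      d≢0 : d ≢ 0#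
      d≢0 = z≢1 ∘ x-y≡0⇒x≡y
      eq : f a b w ≡ a + a * (b * d)
      eq = trans (cong (λ e → f a b (1# + e)) (sym (f-square s)))
        (trans (automorphism-at-1 sz) (cong (λ e → a + a * e) (f-square s)))
      by-cases : ¬ Dec (Square w)
      by-cases (yes sw) = *-nonzero a≢0 (*-nonzero a-b≢0 d≢0) (multiple 1# (trans (sym (f-square sw)) eq)
        (solve 3 (λ a b d → a :* ((a :- b) :* d) :- con 0ℤ := one :* (a :* (one :+ a :* d) :- (a :+ a :* (b :* d)))) refl a b d))
      by-cases (no ¬sw) = a-b≢0 (multiple (- 1#) (trans (sym (f-nonsquare ¬sw)) eq)
        (solve 3 (λ a b d → a :- b :- con 0ℤ := :- one :* (b :* (one :+ a :* d) :- (a :+ a :* (b :* d)))) refl a b d))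

    -- Now `d = z - 1` is a nonsquare. If `1 + b * d` is a square, `a * (a - b) * d = 0` follows,
    -- which is absurd; otherwise `(a - b) * (1 + (a + b) * d) = 0`.
    square-determined : ∀ {z} → Square z → z ≢ 1# → 1# + (a + b) * (z - 1#) ≡ 0#
    square-determined {z} sz z≢1 = by-cases (square? w)
      where
      d = z - 1#
      w = 1# + b * d
      ¬s : ¬ Square d
      ¬s = z-1-nonsquare sz z≢1
      d≢0 : d ≢ 0#
      d≢0 = z≢1 ∘ x-y≡0⇒x≡y
      eq : f a b w ≡ a + a * (a * d)
      eq = trans (cong (λ e → f a b (1# + e)) (sym (f-nonsquare ¬s)))
        (trans (automorphism-at-1 sz) (cong (λ e → a + a * e) (f-nonsquare ¬s)))
      by-cases : Dec (Square w) → 1# + (a + b) * d ≡ 0#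
      by-cases (yes sw) = contradiction (multiple (- 1#) (trans (sym (f-square sw)) eq)
        (solve 3 (λ a b d → a :* ((a :- b) :* d) :- con 0ℤ := :- one :* (a :* (one :+ b :* d) :- (a :+ a :* (a :* d)))) refl a b d))
        (*-nonzero a≢0 (*-nonzero a-b≢0 d≢0))
      by-cases (no ¬sw) = *-cancelˡ a-b≢0 (multiple (- 1#) (trans (sym (f-nonsquare ¬sw)) eq)
        (solve 3 (λ a b d → (a :- b) :* (one :+ (a :+ b) :* d) :- (a :- b) :* con 0ℤ
          := :- one :* (b :* (one :+ b :* d) :- (a :+ a :* (a :* d)))) refl a b d))

    -- z and its inverse are both determined by the same linear equation, hence equal.
    square-involutive : ∀ {z} → z ≢ 0# → Square z → z * z ≡ 1#
    square-involutive {z} z≢0 sz = Sum.[ (λ { refl → *-identityˡ 1# }) , nontrivial ]′ (toSum (z ≟ 1#))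
      where
      i = z ⁻¹
      zi = *-inverseʳ z≢0
      nontrivial : z ≢ 1# → z * z ≡ 1#
      nontrivial z≢1 = trans (cong (z *_) z≡i) zi
        where
        i≢1 : i ≢ 1#
        i≢1 e = z≢1 (trans (sym (*-identityʳ z)) (trans (cong (z *_) (sym e)) zi))
        e₁ : 1# + (a + b) * (z - 1#) ≡ 0#
        e₁ = square-determined sz z≢1
        e₂ : 1# + (a + b) * (i - 1#) ≡ 0#
        e₂ = square-determined (⁻¹-square sz) i≢1
        a+b≢0 : a + b ≢ 0#
        a+b≢0 e = 1≢0 (multiple₂ 1# (1# - z) e₁ e
          (solve 3 (λ a b z → one :- con 0ℤ
            := one :* (one :+ (a :+ b) :* (z :- one) :- con 0ℤ) :+ (one :- z) :* (a :+ b :- con 0ℤ)) refl a b z))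
        z≡i : z ≡ i
        z≡i = *-cancelˡ a+b≢0 (multiple₂ 1# (- 1#) e₁ e₂
          (solve 4 (λ a b z i → (a :+ b) :* z :- (a :+ b) :* i
            := one :* (one :+ (a :+ b) :* (z :- one) :- con 0ℤ) :+ :- one :* (one :+ (a :+ b) :* (i :- one) :- con 0ℤ)) refl a b z i))

    -- Applied to the square `c * c`, `square-involutive` gives `c⁴ = 1`; and `c = 1` is excluded
    -- because 1 is a square.
    nonsquare²≡±1 : ∀ {c} → ¬ Square c → c ≡ - 1# ⊎ c * c ≡ - 1#
    nonsquare²≡±1 {c} ¬sc = Sum.[ c²≡1⇒c≡-1 , inj₂ ]′
      (x²≡y²⇒x≡±y (trans (square-involutive (*-nonzero c≢0 c≢0) (c , refl)) (sym (*-identityˡ 1#))))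
      where
      c≢0 = ¬square⇒≢0 ¬sc
      c²≡1⇒c≡-1 : c * c ≡ 1# → c ≡ - 1# ⊎ c * c ≡ - 1#
      c²≡1⇒c≡-1 c²≡1 = Sum.[ (λ { refl → contradiction 1-square ¬sc }) , inj₁ ]′
        (x²≡y²⇒x≡±y (trans c²≡1 (sym (*-identityˡ 1#))))

    1-a*1-b-square : Square ((1# - a) * (1# - b))
    1-a*1-b-square = by-cases q
      where
      by-cases : Paired (1# - a) (1# - b) → Square ((1# - a) * (1# - b))
      by-cases (both-square _ _ s s′) = *-square s s′
      by-cases (both-nonsquare ¬s ¬s′) = nonsquare*nonsquare ¬s ¬s′

    -- If a² = b² = -1 then b = -a, so 2 = (1 - a)(1 - b) and 2a = (1 + a)² are squares.
    impossible : ⊥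
    impossible = by-cases (nonsquare²≡±1 ¬sa) (nonsquare²≡±1 ¬sb)
      where
      by-cases : a ≡ - 1# ⊎ a * a ≡ - 1# → b ≡ - 1# ⊎ b * b ≡ - 1# → ⊥
      by-cases (inj₁ a≡-1) (inj₁ b≡-1) = contradiction (trans a≡-1 (sym b≡-1)) a≢b
      by-cases (inj₁ a≡-1) (inj₂ b²≡-1) = contradiction (b , trans b²≡-1 (sym a≡-1)) ¬sa
      by-cases (inj₂ a²≡-1) (inj₁ b≡-1) = contradiction (a , trans a²≡-1 (sym b≡-1)) ¬sb
      by-cases (inj₂ a²≡-1) (inj₂ b²≡-1) = Sum.[ a≢b , ¬sa ∘ a-square ]′ (x²≡y²⇒x≡±y (trans a²≡-1 (sym b²≡-1)))
        where
        a-square : a ≡ - b → Square a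
        a-square a≡-b = *-square-cancel 2≢0
          (subst Square (multiple₂ (- 1# + a) (- 1#) a≡-b a²≡-1 (solve 2 (λ a b → (one :- a) :* (one :- b) :- (one :+ one)
            := (:- one :+ a) :* (a :- :- b) :+ :- one :* (a :* a :- :- one)) refl a b)) 1-a*1-b-square)
          (1# + a , multiple 1# a²≡-1 (solve 1 (λ a → (one :+ a) :* (one :+ a) :- (one :+ one) :* a := one :* (a :* a :- :- one)) refl a))

  leftDistributive⇒a≡b : ∀ {a b} → Paired a b → Paired (1# - a) (1# - b) → LeftDistributive (quadOp a b) → a ≡ b
  leftDistributive⇒a≡b {a} {b} p q ld = decidable-stable (a ≟ b) (by-cases p)
    where
    by-cases : Paired a b → ¬ a ≢ b
    by-cases (both-square a≢0 _ sa _) = leftDistributive-square sa a≢0 p q ld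
    by-cases (both-nonsquare ¬sa ¬sb) a≢b = NonsquareCase.impossible ¬sa ¬sb q ld a≢b

  1-a≡1-b⇒a≡b : ∀ {a b} → 1# - a ≡ 1# - b → a ≡ b
  1-a≡1-b⇒a≡b {a} {b} e = multiple (- 1#) e (solve 2 (λ a b → a :- b := :- one :* (one :- a :- (one :- b))) refl a b)

  -- The opposite is quadratic and left distributive, so its parameters agree; they are `1# - a` and
  -- `1# - b` in some order.
  rightDistributive⇒a≡b : ∀ {a b} → Paired a b → Paired (1# - a) (1# - b) → RightDistributive (quadOp a b) → a ≡ b
  rightDistributive⇒a≡b {a} {b} p q rd with quadOp-flip a b p q
  ... | c , d , params , p′ , q′ , flip = parameters params (leftDistributive⇒a≡b p′ q′ ld)
    where
    _∘₁_ = quadOp a b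
    _∘₂_ = quadOp c d
    ld : LeftDistributive (quadOp c d)
    ld x y z = begin
      x ∘₂ (y ∘₂ z)           ≡⟨ cong (x ∘₂_) (sym (flip y z)) ⟩
      x ∘₂ (z ∘₁ y)           ≡⟨ sym (flip x _) ⟩
      (z ∘₁ y) ∘₁ x           ≡⟨ rd z y x ⟩
      (z ∘₁ x) ∘₁ (y ∘₁ x)    ≡⟨ cong₂ _∘₁_ (flip x z) (flip x y) ⟩
      (x ∘₂ z) ∘₁ (x ∘₂ y)    ≡⟨ flip _ _ ⟩
      (x ∘₂ y) ∘₂ (x ∘₂ z)    ∎
      where open ≡-Reasoning
    parameters : FlipParameters a b c d → c ≡ d → a ≡ b
    parameters (flip-square _) e = 1-a≡1-b⇒a≡b e
    parameters (flip-nonsquare _) e = 1-a≡1-b⇒a≡b (sym e)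

  -- By idempotence, `x · yz = xx · yz = xy · xz`.
  medial⇒leftDistributive : ∀ {a b} → Medial _≡_ (quadOp a b) → LeftDistributive (quadOp a b)
  medial⇒leftDistributive {a} {b} medial x y z =
    trans (cong (λ w → quadOp a b w (quadOp a b y z)) (sym (quadOp-idempotent a b x))) (medial x x y z)

  -- With equal parameters the product is `(1 - a) x + a y`, so in `xy · uv` both `y` and `u` have
  -- coefficient `a (1 - a)`.
  diagonal-medial : ∀ a → Medial _≡_ (quadOp a a)
  diagonal-medial a x y u v = trans (expand x y u v) (trans (solve 5 (λ a x y u v →
      x :+ a :* (y :- x) :+ a :* (u :+ a :* (v :- u) :- (x :+ a :* (y :- x)))
      := x :+ a :* (u :- x) :+ a :* (y :+ a :* (v :- y) :- (x :+ a :* (u :- x)))) refl a x y u v) (sym (expand x u y v)))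
    where
    expand : ∀ x y u v → quadOp a a (quadOp a a x y) (quadOp a a u v)
      ≡ x + a * (y - x) + a * (u + a * (v - u) - (x + a * (y - x)))
    expand x y u v = trans (quadOp-diagonal a _ _)
      (cong₂ (λ s t → s + a * (t - s)) (quadOp-diagonal a x y) (quadOp-diagonal a u v))

  medial⇒rightDistributive : ∀ {a b} → Medial _≡_ (quadOp a b) → RightDistributive (quadOp a b)
  medial⇒rightDistributive {a} {b} medial x y z =
    trans (cong (quadOp a b (quadOp a b x y)) (sym (quadOp-idempotent a b z))) (medial x y z z)

-- Commutative, flexible, semisymmetric and Steiner quasigroups.

module Identities (F : FiniteField) (odd : FiniteField.order F % 2 ≡ 1) where
  open FiniteField F
  open Distributivity F odd public
  open Characteristic F odd

  -- The quasigroup and its opposite have the same parameters. If -1 is a square, `a = 1 - a` and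
  -- `b = 1 - b`, so both are 1/2; otherwise `a = 1 - b`.
  commutative⇒ : ∀ {a b} → Paired a b → Paired (1# - a) (1# - b) → Commutative _≡_ (quadOp a b) →
    a + b ≡ 1# × (order % 4 ≡ 3 ⊎ a ≡ b)
  commutative⇒ {a} {b} p q comm with quadOp-flip a b p q
  ... | c , d , params , _ , _ , flip = parameters params (f-injective-parameters same)
    where
    same : ∀ y → f a b y ≡ f c d y
    same y = trans (sym (quadOp-0ˡ a b y)) (trans (comm 0# y) (trans (flip 0# y) (quadOp-0ˡ c d y)))
    parameters : ∀ {c d} → FlipParameters a b c d → a ≡ c × b ≡ d → a + b ≡ 1# × (order % 4 ≡ 3 ⊎ a ≡ b)
    parameters (flip-square _) (ea , eb) = trans (cong (λ z → a + z) (sym a≡b)) (multiple 1# ea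
        (solve 1 (λ a → a :+ a :- one := one :* (a :- (one :- a))) refl a)) , inj₂ a≡b
      where
      a≡b : a ≡ b
      a≡b = *-cancelˡ 2≢0 (multiple₂ 1# (- 1#) ea eb
        (solve 2 (λ a b → (one :+ one) :* a :- (one :+ one) :* b := one :* (a :- (one :- a)) :+ :- one :* (b :- (one :- b))) refl a b))
    parameters (flip-nonsquare ¬sq) (ea , _) =
      multiple 1# ea (solve 2 (λ a b → a :+ b :- one := one :* (a :- (one :- b))) refl a b) , inj₁ (-1-nonsquare⇒order≡3 ¬sq)

  commutative⇐ : ∀ {a b} → a + b ≡ 1# → order % 4 ≡ 3 ⊎ a ≡ b → Commutative _≡_ (quadOp a b)
  commutative⇐ {a} {b} a+b≡1 (inj₁ order≡3) x y = sym (trans (quadOp-flip-nonsquare (order≡3⇒-1-nonsquare order≡3) a b x y)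
    (cong₂ (λ c d → quadOp c d x y)
      (multiple (- 1#) a+b≡1 (solve 2 (λ a b → one :- b :- a := :- one :* (a :+ b :- one)) refl a b))
      (multiple (- 1#) a+b≡1 (solve 2 (λ a b → one :- a :- b := :- one :* (a :+ b :- one)) refl a b))))
  commutative⇐ {a} a+a≡1 (inj₂ refl) x y = trans (quadOp-diagonal a x y) (trans
    (multiple (y - x) a+a≡1 (solve 3 (λ a x y → x :+ a :* (y :- x) :- (y :+ a :* (x :- y)) := (y :- x) :* (a :+ a :- one)) refl a x y))
    (sym (quadOp-diagonal a y x)))

  -- Multiplying by `x` on the right is multiplying by `x` on the left in the opposite, so only a
  -- composite of two maps f applied to `y - x` remains.
  [xy]x-f : ∀ {a b c d} → (∀ x y → quadOp a b y x ≡ quadOp c d x y) → ∀ x y →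
    quadOp a b (quadOp a b x y) x ≡ x + f c d (f a b (y - x))
  [xy]x-f {a} {b} {c} {d} flip x y = trans (flip x _) (trans (quadOp-f c d x _) (cong (λ z → x + f c d z)
    (trans (cong (_- x) (quadOp-f a b x y)) (solve 2 (λ x z → x :+ z :- x := z) refl x _))))

  x[yx]-f : ∀ {a b c d} → (∀ x y → quadOp a b y x ≡ quadOp c d x y) → ∀ x y →
    quadOp a b x (quadOp a b y x) ≡ x + f a b (f c d (y - x))
  x[yx]-f {a} {b} {c} {d} flip x y = trans (quadOp-f a b x _) (cong (λ z → x + f a b z)
    (trans (cong (_- x) (trans (flip x y) (quadOp-f c d x y))) (solve 2 (λ x z → x :+ z :- x := z) refl x _)))

  +-cancelˡ : ∀ x {y z} → x + y ≡ x + z → y ≡ z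
  +-cancelˡ x {y} {z} e = multiple 1# e (solve 3 (λ x y z → y :- z := one :* (x :+ y :- (x :+ z))) refl x y z)

  [x-y][1-x-y]≡0 : ∀ {a b} → (a - b) * (1# - a - b) ≡ 0# → a ≡ b ⊎ a + b ≡ 1#
  [x-y][1-x-y]≡0 {a} {b} e = Sum.map x-y≡0⇒x≡y
    (λ e′ → multiple (- 1#) e′ (solve 2 (λ a b → a :+ b :- one := :- one :* (one :- a :- b :- con 0ℤ)) refl a b))
    (xy≡0⇒x≡0⊎y≡0 e)

  x-0 : ∀ x → x - 0# ≡ x
  x-0 = solve 1 (λ x → x :- con 0ℤ := x) refl

  Flexible-condition : Carrier → Carrier → Set
  Flexible-condition a b = a ≡ b ⊎ (χ a ≡ 1ℤ × χ (1# - a) ≡ 1ℤ) ⊎ (a + b ≡ 1# × order % 4 ≡ 3)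

  -- Flexibility says that `f a b` and `f c d` commute. If both pairs are squares, the second
  -- alternative holds. If just one pair is, comparing parameters gives `a = b` or `c = d`. If
  -- neither is, `d * a = b * c`, which means `a = b` when -1 is a square and
  -- `(a - b) * (1 - a - b) = 0` otherwise.
  flexible⇒ : ∀ {a b} → Paired a b → Paired (1# - a) (1# - b) → Flexible _≡_ (quadOp a b) → Flexible-condition a b
  flexible⇒ {a} {b} p q flex with quadOp-flip a b p q
  ... | c , d , params , p′ , _ , flip = by-cases params p p′ same
    where
    same : ∀ y → f c d (f a b y) ≡ f a b (f c d y)
    same y = subst (λ z → f c d (f a b z) ≡ f a b (f c d z)) (x-0 y)
      (+-cancelˡ 0# (trans (sym ([xy]x-f flip 0# y)) (trans (flex 0# y) (x[yx]-f flip 0# y))))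
    equate : ∀ {c d k l m n} → (∀ y → f c d (f a b y) ≡ f k l y) → (∀ y → f a b (f c d y) ≡ f m n y) →
      (∀ y → f c d (f a b y) ≡ f a b (f c d y)) → k ≡ m × l ≡ n
    equate left right same = f-injective-parameters (λ y → trans (sym (left y)) (trans (same y) (right y)))
    by-cases : ∀ {c d} → FlipParameters a b c d → Paired a b → Paired c d →
      (∀ y → f c d (f a b y) ≡ f a b (f c d y)) → Flexible-condition a b
    by-cases (flip-square _) (both-square a≢0 _ sa _) (both-square c≢0 _ sc _) _ =
      inj₂ (inj₁ (χ-square a≢0 sa , χ-square c≢0 sc))
    by-cases (flip-nonsquare _) (both-square a≢0 _ sa _) (both-square _ d≢0 _ sd) _ =
      inj₂ (inj₁ (χ-square a≢0 sa , χ-square d≢0 sd))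
    by-cases {c} {d} _ (both-square a≢0 b≢0 sa sb) (both-nonsquare ¬sc ¬sd) same =
      inj₁ (*-cancelˡ (¬square⇒≢0 ¬sc) (trans (proj₁ (equate (f∘f-square a≢0 b≢0 sa sb c d) (f∘f-nonsquare ¬sc ¬sd a b) same)) (*-comm b c)))
    by-cases {c} {d} params (both-nonsquare ¬sa ¬sb) (both-square c≢0 d≢0 sc sd) same = inj₁ (equal params
      (*-cancelˡ (¬square⇒≢0 ¬sa) (trans (*-comm a d) (proj₁ (equate (f∘f-nonsquare ¬sa ¬sb c d) (f∘f-square c≢0 d≢0 sc sd a b) same)))))
      where
      equal : ∀ {c d} → FlipParameters a b c d → d ≡ c → a ≡ b
      equal (flip-square _) e = 1-a≡1-b⇒a≡b (sym e)
      equal (flip-nonsquare _) e = 1-a≡1-b⇒a≡b e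
    by-cases {c} {d} params (both-nonsquare ¬sa ¬sb) (both-nonsquare ¬sc ¬sd) same =
      conclude params (proj₁ (equate (f∘f-nonsquare ¬sa ¬sb c d) (f∘f-nonsquare ¬sc ¬sd a b) same))
      where
      conclude : ∀ {c d} → FlipParameters a b c d → d * a ≡ b * c → Flexible-condition a b
      conclude (flip-square _) e = inj₁ (multiple 1# e
        (solve 2 (λ a b → a :- b := one :* ((one :- b) :* a :- b :* (one :- a))) refl a b))
      conclude (flip-nonsquare ¬sq) e = Sum.map (λ a≡b → a≡b) (λ a+b≡1 → inj₂ (a+b≡1 , -1-nonsquare⇒order≡3 ¬sq))
        ([x-y][1-x-y]≡0 (multiple 1# e
          (solve 2 (λ a b → (a :- b) :* (one :- a :- b) :- con 0ℤ := one :* ((one :- a) :* a :- b :* (one :- b))) refl a b)))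

  commutative⇒flexible : ∀ {a b} → Commutative _≡_ (quadOp a b) → Flexible _≡_ (quadOp a b)
  commutative⇒flexible {a} {b} comm x y = trans (comm _ x) (cong (quadOp a b x) (comm x y))

  flexible⇐ : ∀ {a b} → Paired a b → Paired (1# - a) (1# - b) → Flexible-condition a b → Flexible _≡_ (quadOp a b)
  flexible⇐ {a} _ _ (inj₁ refl) x y = trans (expandˡ x y) (trans
      (solve 3 (λ a x y → x :+ a :* (y :- x) :+ a :* (x :- (x :+ a :* (y :- x))) := x :+ a :* (y :+ a :* (x :- y) :- x)) refl a x y)
      (sym (expandʳ x y)))
    where
    expandˡ : ∀ x y → quadOp a a (quadOp a a x y) x ≡ x + a * (y - x) + a * (x - (x + a * (y - x)))
    expandˡ x y = trans (quadOp-diagonal a _ _) (cong (λ s → s + a * (x - s)) (quadOp-diagonal a x y))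
    expandʳ : ∀ x y → quadOp a a x (quadOp a a y x) ≡ x + a * (y + a * (x - y) - x)
    expandʳ x y = trans (quadOp-diagonal a _ _) (cong (λ s → x + a * (s - x)) (quadOp-diagonal a y x))
  flexible⇐ {a} {b} p q (inj₂ (inj₁ (χa≡1 , χ1-a≡1))) with quadOp-flip a b p q
  ... | c , d , params , p′ , _ , flip = λ x y →
      trans ([xy]x-f flip x y) (trans (cong (λ z → x + z) (commute p p′ (c-square params p′) (y - x))) (sym (x[yx]-f flip x y)))
    where
    -- `1# - a` is `c` or `d` depending on -1; since `c` and `d` are paired, `c` is a square either
    -- way.
    c-square : ∀ {c d} → FlipParameters a b c d → Paired c d → Square c
    c-square (flip-square _) _ = χ≡1⇒square χ1-a≡1
    c-square (flip-nonsquare _) (both-square _ _ sc _) = sc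
    c-square (flip-nonsquare _) (both-nonsquare _ ¬sd) = contradiction (χ≡1⇒square χ1-a≡1) ¬sd
    commute : Paired a b → Paired c d → Square c → ∀ z → f c d (f a b z) ≡ f a b (f c d z)
    commute (both-nonsquare ¬sa _) _ _ _ = contradiction (χ≡1⇒square χa≡1) ¬sa
    commute _ (both-nonsquare ¬sc _) sc _ = contradiction sc ¬sc
    commute (both-square a≢0 b≢0 sa sb) (both-square c≢0 d≢0 sc sd) _ z = trans (f∘f-square a≢0 b≢0 sa sb c d z)
      (trans (cong₂ (λ k l → f k l z) (*-comm c a) (*-comm d b)) (sym (f∘f-square c≢0 d≢0 sc sd a b z)))
  flexible⇐ _ _ (inj₂ (inj₂ (a+b≡1 , order≡3))) = commutative⇒flexible (commutative⇐ a+b≡1 (inj₁ order≡3))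

  Semisymmetric-condition : Carrier → Carrier → Set
  Semisymmetric-condition a b = a * a - a + 1# ≡ 0# × (a ≡ b ⊎ a + b ≡ 1#)

  -- Semisymmetry says that `f c d` undoes `f a b`. If `a` and -1 have the same character, the
  -- composite has parameters `(1 - a) a` and `(1 - b) b`, treated in `same`; otherwise `(1 - b) a`
  -- and `(1 - a) b`, treated in `cross`, where equating both with 1 forces `a = b`.
  semisymmetric⇒ : ∀ {a b} → Paired a b → Paired (1# - a) (1# - b) → Semisymmetric (quadOp a b) → Semisymmetric-condition a b
  semisymmetric⇒ {a} {b} p q semi with quadOp-flip a b p q
  ... | c , d , params , _ , _ , flip = by-cases params p inverse′
    where
    inverse′ : ∀ y → f c d (f a b y) ≡ y
    inverse′ y = subst (λ z → f c d (f a b z) ≡ z) (x-0 y)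
      (+-cancelˡ 0# (trans (sym ([xy]x-f flip 0# y)) (trans (semi 0# y) (solve 1 (λ y → y := con 0ℤ :+ (y :- con 0ℤ)) refl y))))
    same : (1# - a) * a ≡ 1# → (1# - b) * b ≡ 1# → Semisymmetric-condition a b
    same ea eb = multiple (- 1#) ea (solve 1 (λ a → a :* a :- a :+ one :- con 0ℤ := :- one :* ((one :- a) :* a :- one)) refl a) ,
      [x-y][1-x-y]≡0 (multiple₂ 1# (- 1#) ea eb (solve 2 (λ a b → (a :- b) :* (one :- a :- b) :- con 0ℤ
        := one :* ((one :- a) :* a :- one) :+ :- one :* ((one :- b) :* b :- one)) refl a b))
    cross : (1# - b) * a ≡ 1# → (1# - a) * b ≡ 1# → Semisymmetric-condition a b
    cross ea eb = multiple₂ (- 1#) (- a) ea (sym a≡b)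
        (solve 2 (λ a b → a :* a :- a :+ one :- con 0ℤ := :- one :* ((one :- b) :* a :- one) :+ :- a :* (b :- a)) refl a b) , inj₁ a≡b
      where
      a≡b : a ≡ b
      a≡b = multiple₂ 1# (- 1#) ea eb (solve 2 (λ a b → a :- b
        := one :* ((one :- b) :* a :- one) :+ :- one :* ((one :- a) :* b :- one)) refl a b)
    units : ∀ {c d k l} → (∀ y → f c d (f a b y) ≡ f k l y) → (∀ y → f c d (f a b y) ≡ y) → k ≡ 1# × l ≡ 1#
    units left inv = f-injective-parameters λ y → trans (sym (left y)) (trans (inv y) (sym (f-1-1 refl refl y)))
    by-cases : ∀ {c d} → FlipParameters a b c d → Paired a b → (∀ y → f c d (f a b y) ≡ y) → Semisymmetric-condition a b
    by-cases (flip-square _) (both-square a≢0 b≢0 sa sb) inv = let ea , eb = units (f∘f-square a≢0 b≢0 sa sb _ _) inv in same ea eb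
    by-cases (flip-nonsquare _) (both-square a≢0 b≢0 sa sb) inv = let ea , eb = units (f∘f-square a≢0 b≢0 sa sb _ _) inv in cross ea eb
    by-cases (flip-square _) (both-nonsquare ¬sa ¬sb) inv = let ea , eb = units (f∘f-nonsquare ¬sa ¬sb _ _) inv in cross ea eb
    by-cases (flip-nonsquare _) (both-nonsquare ¬sa ¬sb) inv = let ea , eb = units (f∘f-nonsquare ¬sa ¬sb _ _) inv in same ea eb

  -- Gives `b` the same character as -1, which rules out the crossed composites in `semisymmetric⇐`.
  b≡-a² : ∀ {a b} → a * a - a + 1# ≡ 0# → a + b ≡ 1# → - 1# * (a * a) ≡ b
  b≡-a² {a} {b} e e′ = multiple₂ (- 1#) (- 1#) e e′ (solve 2 (λ a b → :- one :* (a :* a) :- b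
    := :- one :* (a :* a :- a :+ one :- con 0ℤ) :+ :- one :* (a :+ b :- one)) refl a b)

  -1-nonsquare⇒b-nonsquare : ∀ {a b} → a ≢ 0# → a * a - a + 1# ≡ 0# → a + b ≡ 1# → ¬ Square (- 1#) → ¬ Square b
  -1-nonsquare⇒b-nonsquare {a} {b} a≢0 e e′ ¬sq sb = square*nonsquare (*-nonzero a≢0 a≢0) (a , refl) ¬sq
    (subst Square (trans (sym (b≡-a² e e′)) (*-comm _ _)) sb)

  semisymmetric⇐ : ∀ {a b} → Paired a b → Paired (1# - a) (1# - b) → Semisymmetric-condition a b → Semisymmetric (quadOp a b)
  semisymmetric⇐ {a} _ _ (e , inj₁ refl) x y = trans (quadOp-diagonal a _ _) (trans
    (cong (λ s → s + a * (x - s)) (quadOp-diagonal a x y))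
    (multiple (x - y) e (solve 3 (λ a x y → x :+ a :* (y :- x) :+ a :* (x :- (x :+ a :* (y :- x))) :- y
      := (x :- y) :* (a :* a :- a :+ one :- con 0ℤ)) refl a x y)))
  semisymmetric⇐ {a} {b} p q (e , inj₂ e′) with quadOp-flip a b p q
  ... | c , d , params , _ , _ , flip = λ x y → trans ([xy]x-f flip x y)
      (trans (cong (λ z → x + z) (by-cases params p (y - x))) (solve 2 (λ x y → x :+ (y :- x) := y) refl x y))
    where
    unit-a : (1# - a) * a ≡ 1#
    unit-a = multiple (- 1#) e (solve 1 (λ a → (one :- a) :* a :- one := :- one :* (a :* a :- a :+ one :- con 0ℤ)) refl a)
    unit-b : (1# - b) * b ≡ 1#
    unit-b = multiple₂ (- 1#) (a - b) e e′ (solve 2 (λ a b → (one :- b) :* b :- one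
      := :- one :* (a :* a :- a :+ one :- con 0ℤ) :+ (a :- b) :* (a :+ b :- one)) refl a b)
    by-cases : ∀ {c d} → FlipParameters a b c d → Paired a b → ∀ z → f c d (f a b z) ≡ z
    by-cases (flip-square _) (both-square a≢0 b≢0 sa sb) z = trans (f∘f-square a≢0 b≢0 sa sb _ _ z) (f-1-1 unit-a unit-b z)
    by-cases (flip-nonsquare ¬sq) (both-square a≢0 _ _ sb) z = contradiction sb (-1-nonsquare⇒b-nonsquare a≢0 e e′ ¬sq)
    by-cases (flip-square sq) (both-nonsquare _ ¬sb) z = contradiction (subst Square (b≡-a² e e′) (*-square sq (a , refl))) ¬sb
    by-cases (flip-nonsquare _) (both-nonsquare ¬sa ¬sb) z = trans (f∘f-nonsquare ¬sa ¬sb _ _ z) (f-1-1 unit-a unit-b z)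

  CharacteristicAbove3 : Set
  CharacteristicAbove3 = Σ ℕ (λ p → HasCharacteristic p × 3 ℕ.< p)

  -- If `a = b`, then `2a = 1` and `a² = 1`, so `4 = 4a² = 1` and 3 would be 0.
  characteristic>3⇒a≢b : ∀ {a b} → CharacteristicAbove3 → a + b ≡ 1# → a * b ≡ 1# → a ≢ b
  characteristic>3⇒a≢b {a} (p , (_ , _ , minimal) , 3<p) e e′ refl = minimal 3 (s≤s z≤n) 3<p
    (multiple₂ (a + a + 1#) (- (1# + 1# + 1# + 1#)) e e′ (solve 1 (λ a → one :+ (one :+ (one :+ con 0ℤ)) :- con 0ℤ
      := (a :+ a :+ one) :* (a :+ a :- one) :+ :- (one :+ one :+ one :+ one) :* (a :* a :- one)) refl a))

  Steiner-condition : Carrier → Carrier → Set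
  Steiner-condition a b = (HasCharacteristic 3 × a ≡ - 1# × b ≡ - 1#)
    ⊎ (CharacteristicAbove3 × a + b ≡ 1# × a * b ≡ 1# × χ a ≡ -1ℤ × χ (- 1#) ≡ -1ℤ)

  steiner⇒ : ∀ {a b} → Paired a b → a + b ≡ 1# → order % 4 ≡ 3 ⊎ a ≡ b → a * a - a + 1# ≡ 0# → Steiner-condition a b
  steiner⇒ {a} {b} p e₁ order∨a≡b e₂ = Sum.map small large characteristic≥3
    where
    -- In characteristic 3, `a² - a + 1` is `(a + 1)²`, and `b = 1 - a` is 2, that is -1.
    small : HasCharacteristic 3 → HasCharacteristic 3 × a ≡ - 1# × b ≡ - 1#
    small h@(_ , 3≡0 , _) = h , a≡-1 , multiple₂ 1# 1# (trans (cong (_+ b) (sym a≡-1)) e₁) 3≡0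
      (solve 1 (λ b → b :- :- one := one :* (:- one :+ b :- one) :+ one :* (one :+ (one :+ (one :+ con 0ℤ)) :- con 0ℤ)) refl b)
      where
      [a+1]²≡0 : (a + 1#) * (a + 1#) ≡ 0#
      [a+1]²≡0 = multiple₂ 1# a e₂ 3≡0 (solve 1 (λ a → (a :+ one) :* (a :+ one) :- con 0ℤ
        := one :* (a :* a :- a :+ one :- con 0ℤ) :+ a :* (one :+ (one :+ (one :+ con 0ℤ)) :- con 0ℤ)) refl a)
      a≡-1 : a ≡ - 1#
      a≡-1 = multiple 1# (Sum.[ (λ e → e) , (λ e → e) ]′ (xy≡0⇒x≡0⊎y≡0 [a+1]²≡0))
        (solve 1 (λ a → a :- :- one := one :* (a :+ one :- con 0ℤ)) refl a)
    -- Here `a ≠ b`, so commutativity leaves only order 3 mod 4, where -1 is a nonsquare. Then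
    -- `b = -a²` is a nonsquare, and `a` with it.
    large : CharacteristicAbove3 → CharacteristicAbove3 × a + b ≡ 1# × a * b ≡ 1# × χ a ≡ -1ℤ × χ (- 1#) ≡ -1ℤ
    large h = h , e₁ , ab≡1 , χ-nonsquare (a-nonsquare p) , χ-nonsquare ¬sq
      where
      ab≡1 : a * b ≡ 1#
      ab≡1 = multiple₂ a (- 1#) e₁ e₂ (solve 2 (λ a b → a :* b :- one
        := a :* (a :+ b :- one) :+ :- one :* (a :* a :- a :+ one :- con 0ℤ)) refl a b)
      ¬sq : ¬ Square (- 1#)
      ¬sq = Sum.[ order≡3⇒-1-nonsquare , (λ a≡b → contradiction a≡b (characteristic>3⇒a≢b h e₁ ab≡1)) ]′ order∨a≡b
      a-nonsquare : Paired a b → ¬ Square a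
      a-nonsquare (both-nonsquare ¬sa _) = ¬sa
      a-nonsquare (both-square a≢0 _ _ sb) = contradiction sb (-1-nonsquare⇒b-nonsquare a≢0 e₂ e₁ ¬sq)

  steiner⇐ : ∀ {a b} → Steiner-condition a b → (a + b ≡ 1# × (order % 4 ≡ 3 ⊎ a ≡ b)) × Semisymmetric-condition a b
  steiner⇐ (inj₁ ((_ , 3≡0 , _) , refl , refl)) =
    (multiple (- 1#) 3≡0 (solve 0 (:- one :+ :- one :- one := :- one :* (one :+ (one :+ (one :+ con 0ℤ)) :- con 0ℤ)) refl) , inj₂ refl) ,
    (multiple 1# 3≡0 (solve 0 (:- one :* :- one :- :- one :+ one :- con 0ℤ
      := one :* (one :+ (one :+ (one :+ con 0ℤ)) :- con 0ℤ)) refl) , inj₁ refl)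
  steiner⇐ {a} {b} (inj₂ (_ , e₁ , e₂ , _ , χ-1)) =
    (e₁ , inj₁ (-1-nonsquare⇒order≡3 (χ≡-1⇒nonsquare χ-1))) ,
    (multiple₂ a (- 1#) e₁ e₂ (solve 2 (λ a b → a :* a :- a :+ one :- con 0ℤ
      := a :* (a :+ b :- one) :+ :- one :* (a :* b :- one)) refl a b) , inj₂ e₁)

-- Actions of the additive group that are equivariant for multiplication by squares.

module EquivariantAction (F : FiniteField) (odd : FiniteField.order F % 2 ≡ 1) where
  open FiniteField F
  open OddField F odd public

  module _ (θ : Carrier → Carrier → Carrier) (θ-0 : ∀ u → θ 0# u ≡ u) (θ-+ : ∀ s t u → θ s (θ t u) ≡ θ (s + t) u)
    (θ-fixes-0 : ∀ t → θ t 0# ≡ 0#)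
    (θ-scale : ∀ {s} → s ≢ 0# → Square s → ∀ t u → θ (s * t) (s * u) ≡ s * θ t u) where

    Orb : Carrier → Carrier → Set
    Orb x y = ∃ λ t → θ t x ≡ y

    Orb? : ∀ x → Decidable (Orb x)
    Orb? x y = map′ satisfied (λ (t , e) → lose (complete t) e) (any? (λ t → θ t x ≟ y) elements)

    θ-inverse : ∀ t x → θ (- t) (θ t x) ≡ x
    θ-inverse t x = trans (θ-+ (- t) t x) (trans (cong (λ z → θ z x) (trans (+-comm _ t) (-‿inverseʳ t))) (θ-0 x))

    Orb-refl : ∀ x → Orb x x
    Orb-refl x = 0# , θ-0 x

    Orb-sym : ∀ {x y} → Orb x y → Orb y x
    Orb-sym (t , refl) = - t , θ-inverse t _

    Orb-trans : ∀ {x y z} → Orb x y → Orb y z → Orb x z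
    Orb-trans (t , refl) (s , refl) = s + t , sym (θ-+ s t _)

    orbit : Carrier → List Carrier
    orbit x = filter (Orb? x) elements

    orbit-unique : ∀ x → Unique (orbit x)
    orbit-unique x = filter⁺ (Orb? x) unique

    ∈-orbit⁺ : ∀ {x y} → Orb x y → y ∈ orbit x
    ∈-orbit⁺ {x} = ∈-filter⁺ (Orb? x) (complete _)

    ∈-orbit⁻ : ∀ {x y} → y ∈ orbit x → Orb x y
    ∈-orbit⁻ {x} y∈ = proj₂ (∈-filter⁻ (Orb? x) {xs = elements} y∈)

    ∣orbit∣ : Carrier → ℕ
    ∣orbit∣ x = length (orbit x)

    ∣orbit∣-cong : ∀ {x y} → Orb x y → ∣orbit∣ x ≡ ∣orbit∣ y
    ∣orbit∣-cong {x} {y} xy = unique-⊆⊇⇒length≡ (orbit-unique x) (orbit-unique y)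
      (λ z∈ → ∈-orbit⁺ (Orb-trans (Orb-sym xy) (∈-orbit⁻ z∈))) (λ z∈ → ∈-orbit⁺ (Orb-trans xy (∈-orbit⁻ z∈)))

    -- By equivariance, multiplication by `s` maps the orbit of `x` into that of `s * x`. The
    -- inverse of `s` yields the opposite inequality in `∣orbit∣-scale`.
    ∣orbit∣-scale-≤ : ∀ {s} → s ≢ 0# → Square s → ∀ x → ∣orbit∣ x ℕ.≤ ∣orbit∣ (s * x)
    ∣orbit∣-scale-≤ {s} s≢0 sq x = subst (ℕ._≤ ∣orbit∣ (s * x)) (length-map (s *_) (orbit x))
      (unique-⊆⇒length≤ (map⁺ (*-cancelˡ s≢0) (orbit-unique x)) sub)
      where
      sub : ∀ {z} → z ∈ map (s *_) (orbit x) → z ∈ orbit (s * x)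
      sub z∈ with ∈-map⁻ (s *_) z∈
      ... | y , y∈ , refl with ∈-orbit⁻ y∈
      ...   | t , refl = ∈-orbit⁺ (s * t , θ-scale s≢0 sq t x)

    ∣orbit∣-scale : ∀ {s} → s ≢ 0# → Square s → ∀ x → ∣orbit∣ (s * x) ≡ ∣orbit∣ x
    ∣orbit∣-scale {s} s≢0 sq x = ℕₚ.≤-antisym
      (subst (λ z → ∣orbit∣ (s * x) ℕ.≤ ∣orbit∣ z) (multiple x (*-inverseʳ s≢0)
        (solve 3 (λ s i x → i :* (s :* x) :- x := x :* (s :* i :- one)) refl s (s ⁻¹) x))
        (∣orbit∣-scale-≤ (⁻¹-nonzero s≢0) (⁻¹-square sq) (s * x)))
      (∣orbit∣-scale-≤ s≢0 sq x)

    o : ℕ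
    o = ∣orbit∣ 1#

    ∣orbit∣-square : ∀ {x} → x ≢ 0# → Square x → ∣orbit∣ x ≡ o
    ∣orbit∣-square {x} x≢0 sq = trans (cong ∣orbit∣ (sym (*-identityʳ x))) (∣orbit∣-scale x≢0 sq 1#)

    -- The quotient of two nonsquares is a nonzero square, and scaling by it preserves orbit sizes.
    ∣orbit∣-nonsquare : ∀ {n x} → ¬ Square n → ¬ Square x → ∣orbit∣ x ≡ ∣orbit∣ n
    ∣orbit∣-nonsquare {n} {x} ¬sn ¬sx = trans (cong ∣orbit∣ x≡[xn⁻¹]n) (∣orbit∣-scale xn⁻¹≢0 sq n)
      where
      n≢0 = ¬square⇒≢0 ¬sn
      xn⁻¹≢0 : x * n ⁻¹ ≢ 0#
      xn⁻¹≢0 = *-nonzero (¬square⇒≢0 ¬sx) (⁻¹-nonzero n≢0)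
      sq : Square (x * n ⁻¹)
      sq = nonsquare*nonsquare ¬sx (⁻¹-nonsquare ¬sn)
      x≡[xn⁻¹]n : x ≡ x * n ⁻¹ * n
      x≡[xn⁻¹]n = multiple (- x) (*-inverseʳ n≢0) (solve 3 (λ x n i → x :- x :* i :* n := :- x :* (n :* i :- one)) refl x n (n ⁻¹))

    same-size : List Carrier
    same-size = filter (λ x → ∣orbit∣ x ℕ.≟ o) nonzeros

    same-size-unique : Unique same-size
    same-size-unique = filter⁺ (λ x → ∣orbit∣ x ℕ.≟ o) nonzeros-unique

    ∈-same-size⁺ : ∀ {x} → x ≢ 0# → ∣orbit∣ x ≡ o → x ∈ same-size
    ∈-same-size⁺ x≢0 = ∈-filter⁺ (λ x → ∣orbit∣ x ℕ.≟ o) (∈-nonzeros⁺ x≢0)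

    ∈-same-size⁻ : ∀ {x} → x ∈ same-size → x ≢ 0# × ∣orbit∣ x ≡ o
    ∈-same-size⁻ x∈ with ∈-filter⁻ (λ x → ∣orbit∣ x ℕ.≟ o) {xs = nonzeros} x∈
    ... | x∈nz , e = ∈-nonzeros⁻ x∈nz , e

    -- `same-size` is a union of whole orbits: orbit size is constant along an orbit, and the orbit
    -- of a nonzero element avoids the fixed point 0.
    o∣∣same-size∣ : o ∣ length same-size
    o∣∣same-size∣ = equal-classes⇒∣ Orb? Orb-refl Orb-sym Orb-trans o same-size size
      where
      size : ∀ {x} → x ∈ same-size → length (filter (Orb? x) same-size) ≡ o
      size {x} x∈ with ∈-same-size⁻ x∈
      ... | x≢0 , e = trans (unique-⊆⊇⇒length≡ (filter⁺ (Orb? x) same-size-unique) (orbit-unique x)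
          (λ y∈ → ∈-orbit⁺ (proj₂ (∈-filter⁻ (Orb? x) {xs = same-size} y∈))) from) e
        where
        nonzero : ∀ {y} → Orb x y → y ≢ 0#
        nonzero (t , e′) refl = x≢0 (trans (sym (θ-inverse t x)) (trans (cong (θ (- t)) e′) (θ-fixes-0 _)))
        from : ∀ {y} → y ∈ orbit x → y ∈ filter (Orb? x) same-size
        from y∈ = let xy = ∈-orbit⁻ y∈ in
          ∈-filter⁺ (Orb? x) (∈-same-size⁺ (nonzero xy) (trans (sym (∣orbit∣-cong xy)) e)) xy

    -- All nonsquares have orbits of one common size. If it is `o`, `same-size` consists of all
    -- nonzero elements; otherwise of the nonzero squares, which are half of them.
    o∣∣nonzeros∣ : ∀ {n} → ¬ Square n → o ∣ length nonzeros
    o∣∣nonzeros∣ {n} ¬sn = by-cases (∣orbit∣ n ℕ.≟ o)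
      where
      by-cases : Dec (∣orbit∣ n ≡ o) → o ∣ length nonzeros
      by-cases (yes e) = subst (o ∣_) (unique-⊆⊇⇒length≡ same-size-unique nonzeros-unique
          (λ x∈ → ∈-nonzeros⁺ (proj₁ (∈-same-size⁻ x∈))) (λ x∈ → all (∈-nonzeros⁻ x∈))) o∣∣same-size∣
        where
        all : ∀ {x} → x ≢ 0# → x ∈ same-size
        all {x} x≢0 with square? x
        ... | yes sq = ∈-same-size⁺ x≢0 (∣orbit∣-square x≢0 sq)
        ... | no ¬sq = ∈-same-size⁺ x≢0 (trans (∣orbit∣-nonsquare ¬sn ¬sq) e)
      by-cases (no ne) = subst (o ∣_) (sym ∣nonzeros∣≡2∣squares∣) (∣-trans (subst (o ∣_)
          (unique-⊆⊇⇒length≡ same-size-unique squares-unique to from) o∣∣same-size∣) (m∣m*n 2))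
        where
        to : ∀ {x} → x ∈ same-size → x ∈ squares
        to {x} x∈ with ∈-same-size⁻ x∈ | square? x
        ... | x≢0 , _ | yes sq = ∈-squares⁺ x≢0 sq
        ... | _ , e | no ¬sq = contradiction (trans (∣orbit∣-nonsquare ¬sq ¬sn) e) ne
        from : ∀ {x} → x ∈ squares → x ∈ same-size
        from x∈ with ∈-squares⁻ x∈
        ... | x≢0 , sq = ∈-same-size⁺ x≢0 (∣orbit∣-square x≢0 sq)

    -- A coset of the stabiliser of `1#` when `y` lies in the orbit of `1#`, and empty otherwise.
    transporter : Carrier → List Carrier
    transporter y = filter (λ t → θ t 1# ≟ y) elements

    ∣transporter∣ : ∀ {y} → Orb 1# y → length (transporter y) ≡ length (transporter 1#)
    ∣transporter∣ (r , refl) = trans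
        (sym (unique-⊆⊇⇒length≡ (map⁺ (λ {x} {y} → cancel x y) (filter⁺ _ unique)) (filter⁺ _ unique) to from))
        (length-map (λ z → r + z) (transporter 1#))
      where
      cancel : ∀ x y → r + x ≡ r + y → x ≡ y
      cancel x y e = multiple 1# e (solve 3 (λ r x y → x :- y := one :* (r :+ x :- (r :+ y))) refl r x y)
      to : ∀ {t} → t ∈ map (λ z → r + z) (transporter 1#) → t ∈ transporter (θ r 1#)
      to t∈ with ∈-map⁻ (λ z → r + z) t∈
      ... | t , t∈′ , refl = ∈-filter⁺ (λ t → θ t 1# ≟ θ r 1#) (complete _)
        (trans (sym (θ-+ r t 1#)) (cong (θ r) (proj₂ (∈-filter⁻ (λ t → θ t 1# ≟ 1#) {xs = elements} t∈′))))
      from : ∀ {t} → t ∈ transporter (θ r 1#) → t ∈ map (λ z → r + z) (transporter 1#)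
      from {t} t∈ = subst (_∈ map (λ z → r + z) (transporter 1#)) (solve 2 (λ r t → r :+ (:- r :+ t) := t) refl r t)
        (∈-map⁺ (λ z → r + z) (∈-filter⁺ (λ t → θ t 1# ≟ 1#) (complete _)
          (trans (sym (θ-+ (- r) t 1#)) (trans (cong (θ (- r)) θt1≡θr1) (θ-inverse r 1#)))))
        where
        θt1≡θr1 : θ t 1# ≡ θ r 1#
        θt1≡θr1 = proj₂ (∈-filter⁻ (λ t → θ t 1# ≟ θ r 1#) {xs = elements} t∈)

    -- Orbit-stabiliser: the map `t ↦ θ t 1#` has fibres of equal size over the orbit of `1#`.
    o∣order : o ∣ order
    o∣order = subst (o ∣_) (sym (equal-fibres⇒length _≟_ (λ t → θ t 1#) (length (transporter 1#)) (orbit 1#) elements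
      (orbit-unique 1#) (λ {t} _ → ∈-orbit⁺ (t , refl)) (λ y∈ → ∣transporter∣ (∈-orbit⁻ y∈)))) (m∣m*n _)

    -- The orbits of size o partition a set of q - 1 or (q - 1)/2 elements, so o divides both q and q - 1.
    o≡1 : o ≡ 1
    o≡1 = ∣1⇒≡1 (∣m+n∣m⇒∣n (subst (o ∣_) (trans order≡1+∣nonzeros∣ (ℕₚ.+-comm 1 _)) o∣order)
      (o∣∣nonzeros∣ (proj₂ ∃-nonsquare)))

    θ-fixes-1 : ∀ t → θ t 1# ≡ 1#
    θ-fixes-1 t = decidable-stable (θ t 1# ≟ 1#) λ ne → contradiction
      (subst (2 ℕ.≤_) o≡1 (unique-⊆⇒length≤ {xs = θ t 1# ∷ 1# ∷ []} ((ne ∷ []) ∷ [] ∷ []) sub)) λ { (s≤s ()) }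
      where
      sub : ∀ {x} → x ∈ θ t 1# ∷ 1# ∷ [] → x ∈ orbit 1#
      sub (here refl) = ∈-orbit⁺ (t , refl)
      sub (there (here refl)) = ∈-orbit⁺ (Orb-refl 1#)

-- Isotopy to groups.

module Isotopy (F : FiniteField) (odd : FiniteField.order F % 2 ≡ 1) where
  open FiniteField F
  open Identities F odd public
  open EquivariantAction F odd using (θ-fixes-1)

  half : Carrier
  half = (1# + 1#) ⁻¹

  -- Carries statements from squares to all elements once they are closed under differences.
  difference-of-squares : ∀ w → w ≡ (w + 1#) * half * ((w + 1#) * half) - (w - 1#) * half * ((w - 1#) * half)
  difference-of-squares w = multiple (- (w * ((1# + 1#) * half + 1#))) (*-inverseʳ 2≢0) (solve 2 (λ w h →
    w :- ((w :+ one) :* h :* ((w :+ one) :* h) :- (w :- one) :* h :* ((w :- one) :* h))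
    := :- (w :* ((one :+ one) :* h :+ one)) :* ((one :+ one) :* h :- one)) refl w half)

  -- An additive f is multiplication by `a` on squares, hence on differences of squares, hence
  -- everywhere; on a nonsquare it is multiplication by `b`.
  f-additive⇒a≡b : ∀ {a b} → (∀ y z → f a b (y + z) ≡ f a b y + f a b z) → a ≡ b
  f-additive⇒a≡b {a} {b} additive = *-cancelʳ (¬square⇒≢0 ¬sn) (trans (sym (f-linear n)) (f-nonsquare ¬sn))
    where
    n = proj₁ ∃-nonsquare
    ¬sn = proj₂ ∃-nonsquare
    f-neg : ∀ y → f a b (- y) ≡ - f a b y
    f-neg y = multiple 1# (trans (sym (additive y (- y))) (trans (cong (f a b) (-‿inverseʳ y)) f-0))
      (solve 2 (λ u v → v :- :- u := one :* (u :+ v :- con 0ℤ)) refl (f a b y) (f a b (- y)))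
    f-difference : ∀ u v → f a b (u * u - v * v) ≡ a * (u * u - v * v)
    f-difference u v = trans (additive _ _) (trans (cong₂ _+_ (f-square (u , refl)) (trans (f-neg _) (cong -_ (f-square (v , refl)))))
      (solve 3 (λ a x y → a :* x :- a :* y := a :* (x :- y)) refl a _ _))
    f-linear : ∀ w → f a b w ≡ a * w
    f-linear w = subst (λ z → f a b z ≡ a * z) (sym (difference-of-squares w)) (f-difference _ _)

  module NormalizedIsotopy {a b} (p : Paired a b) (q : Paired (1# - a) (1# - b)) (G : Group 0ℓ 0ℓ)
    (φ : Carrier → Group.Carrier G)
    (φ-injective : ∀ {x y} → Group._≈_ G (φ x) (φ y) → x ≡ y)
    (φ-surjective : ∀ g → ∃ λ x → Group._≈_ G (φ x) g)
    (φ-0 : Group._≈_ G (φ 0#) (Group.ε G))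
    (φ-quadOp : ∀ x y → Group._≈_ G (φ (quadOp a b x y)) (Group._∙_ G (φ (quadOp a b x 0#)) (φ (quadOp a b 0# y)))) where

    open Group G using (_≈_; _∙_; ε; assoc; identityˡ; identityʳ; inverseʳ; ∙-cong; ∙-congˡ; ∙-congʳ; ⁻¹-cong)
      renaming (_⁻¹ to inv; sym to ≈-sym; trans to ≈-trans; reflexive to ≈-reflexive)
    open Algebra.Properties.Group G using (∙-cancelˡ; ⁻¹-anti-homo-∙; \\-leftDividesʳ; //-rightDividesʳ)
    open Relation.Binary.Reasoning.Setoid (Group.setoid G)

    _⋆_ : Carrier → Carrier → Carrier
    _⋆_ = quadOp a b

    φ-cong : ∀ {x y} → x ≡ y → φ x ≈ φ y
    φ-cong e = ≈-reflexive (cong φ e)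

    ⋆0-surjective : ∀ u → ∃ λ x → x ⋆ 0# ≡ u
    ⋆0-surjective u with quadOp-flip a b p q
    ... | c , d , _ , p′ , _ , flip with f-inverse p′
    ...   | h , _ , fh = h u , trans (flip 0# (h u)) (trans (quadOp-0ˡ c d _) (fh u))

    0⋆-surjective : ∀ v → ∃ λ y → 0# ⋆ y ≡ v
    0⋆-surjective v with f-inverse p
    ... | h , _ , fh = h v , trans (quadOp-0ˡ a b _) (fh v)

    -- Every product in the group is an instance of `φ-quadOp`, so automorphisms of the quasigroup
    -- can be applied to it.
    factor : ∀ {u v w} → φ w ≈ φ u ∙ φ v → ∃ λ x → ∃ λ y → x ⋆ 0# ≡ u × 0# ⋆ y ≡ v × x ⋆ y ≡ w
    factor {u} {v} {w} e with ⋆0-surjective u | 0⋆-surjective v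
    ... | x , refl | y , refl = x , y , refl , refl , φ-injective (≈-trans (φ-quadOp x y) (≈-sym e))

    -- In `φ-translate` the factors `P ∙ S`, `R ∙ S` and `R ∙ Q` are the images of `x ⋆ 0# + t`, `t`
    -- and `0# ⋆ y + t`, and `P ∙ Q` is that of `x ⋆ y + t`.
    cancel-middle : ∀ P Q R S → (P ∙ S) ∙ inv (R ∙ S) ∙ (R ∙ Q) ≈ P ∙ Q
    cancel-middle P Q R S = begin
      (P ∙ S) ∙ inv (R ∙ S) ∙ (R ∙ Q)         ≈⟨ ∙-congʳ (∙-congˡ (⁻¹-anti-homo-∙ R S)) ⟩
      (P ∙ S) ∙ (inv S ∙ inv R) ∙ (R ∙ Q)     ≈⟨ ∙-congʳ (≈-sym (assoc _ _ _)) ⟩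
      (P ∙ S) ∙ inv S ∙ inv R ∙ (R ∙ Q)       ≈⟨ ∙-congʳ (∙-congʳ (//-rightDividesʳ S P)) ⟩
      P ∙ inv R ∙ (R ∙ Q)                     ≈⟨ assoc _ _ _ ⟩
      P ∙ (inv R ∙ (R ∙ Q))                   ≈⟨ ∙-congˡ (\\-leftDividesʳ R Q) ⟩
      P ∙ Q                                   ∎

    -- Translations of F are automorphisms of the quasigroup, hence autotopisms of G.
    φ-translate : ∀ {u v w} t → φ w ≈ φ u ∙ φ v → φ (w + t) ≈ φ (u + t) ∙ inv (φ t) ∙ φ (v + t)
    φ-translate t e with factor e
    ... | x , y , refl , refl , refl = ≈-trans (shift x y) (≈-sym (≈-trans
        (∙-cong (∙-cong (shift x 0#) (⁻¹-cong (≈-trans (φ-cong (sym 0⋆0+t)) (shift 0# 0#)))) (shift 0# y))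
        (cancel-middle _ _ _ _)))
      where
      shift : ∀ x y → φ (x ⋆ y + t) ≈ φ ((x + t) ⋆ 0#) ∙ φ (0# ⋆ (y + t))
      shift x y = ≈-trans (φ-cong (sym (quadOp-+ a b x y t))) (φ-quadOp _ _)
      0⋆0+t : 0# ⋆ 0# + t ≡ t
      0⋆0+t = trans (cong (_+ t) (quadOp-idempotent a b 0#)) (+-identityˡ t)

    -- Multiplication by a nonzero square is an automorphism of the quasigroup fixing 0, so it
    -- respects the factors `x ⋆ 0#` and `0# ⋆ y` and becomes an automorphism of the group.
    φ-scale : ∀ {s u v w} → s ≢ 0# → Square s → φ w ≈ φ u ∙ φ v → φ (s * w) ≈ φ (s * u) ∙ φ (s * v)
    φ-scale {s} s≢0 sq e with factor e
    ... | x , y , refl , refl , refl = ≈-trans (φ-cong (sym (quadOp-square* a b s≢0 sq x y))) (≈-trans (φ-quadOp _ _)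
      (∙-cong (φ-cong (trans (cong ((s * x) ⋆_) (sym (zeroʳ s))) (quadOp-square* a b s≢0 sq x 0#)))
              (φ-cong (trans (cong (_⋆ (s * y)) (sym (zeroʳ s))) (quadOp-square* a b s≢0 sq 0# y)))))

    θ : Carrier → Carrier → Carrier
    θ t u = proj₁ (φ-surjective (inv (φ t) ∙ φ (u + t)))

    φ-θ : ∀ t u → φ (u + t) ≈ φ t ∙ φ (θ t u)
    φ-θ t u = ≈-sym (begin
      φ t ∙ φ (θ t u)                   ≈⟨ ∙-congˡ (proj₂ (φ-surjective (inv (φ t) ∙ φ (u + t)))) ⟩
      φ t ∙ (inv (φ t) ∙ φ (u + t))     ≈⟨ ≈-sym (assoc _ _ _) ⟩
      φ t ∙ inv (φ t) ∙ φ (u + t)       ≈⟨ ∙-congʳ (inverseʳ _) ⟩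
      ε ∙ φ (u + t)                     ≈⟨ identityˡ _ ⟩
      φ (u + t)                         ∎)

    -- Reduces each law of θ to one relation in the group.
    θ-characterised : ∀ t {u v} → φ (u + t) ≈ φ t ∙ φ v → v ≡ θ t u
    θ-characterised t e = φ-injective (∙-cancelˡ (φ t) _ _ (≈-trans (≈-sym e) (φ-θ t _)))

    θ-0 : ∀ u → θ 0# u ≡ u
    θ-0 u = sym (θ-characterised 0# (≈-trans (φ-cong (+-identityʳ u)) (≈-sym (≈-trans (∙-congʳ φ-0) (identityˡ _)))))

    θ-fixes-0 : ∀ t → θ t 0# ≡ 0#
    θ-fixes-0 t = sym (θ-characterised t (≈-trans (φ-cong (+-identityˡ t)) (≈-sym (≈-trans (∙-congˡ φ-0) (identityʳ _)))))

    -- Obtained by translating by `s` the relation that defines `θ t u`.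
    θ-+ : ∀ s t u → θ s (θ t u) ≡ θ (s + t) u
    θ-+ s t u = θ-characterised (s + t) (begin
      φ (u + (s + t))                                        ≈⟨ φ-cong (solve 3 (λ u s t → u :+ (s :+ t) := u :+ t :+ s) refl u s t) ⟩
      φ (u + t + s)                                          ≈⟨ φ-translate s (φ-θ t u) ⟩
      φ (t + s) ∙ inv (φ s) ∙ φ (θ t u + s)                  ≈⟨ ∙-congˡ (φ-θ s (θ t u)) ⟩
      φ (t + s) ∙ inv (φ s) ∙ (φ s ∙ φ (θ s (θ t u)))        ≈⟨ assoc _ _ _ ⟩
      φ (t + s) ∙ (inv (φ s) ∙ (φ s ∙ φ (θ s (θ t u))))      ≈⟨ ∙-congˡ (\\-leftDividesʳ _ _) ⟩
      φ (t + s) ∙ φ (θ s (θ t u))                            ≈⟨ ∙-congʳ (φ-cong (+-comm t s)) ⟩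
      φ (s + t) ∙ φ (θ s (θ t u))                            ∎)

    θ-scale : ∀ {s} → s ≢ 0# → Square s → ∀ t u → θ (s * t) (s * u) ≡ s * θ t u
    θ-scale {s} s≢0 sq t u = sym (θ-characterised (s * t) (≈-trans
      (φ-cong (solve 3 (λ s t u → s :* u :+ s :* t := s :* (u :+ t)) refl s t u)) (φ-scale s≢0 sq (φ-θ t u))))

    -- Equivalent to `u` being fixed by every `θ t`.
    Translating : Carrier → Set
    Translating u = ∀ t → φ (u + t) ≈ φ t ∙ φ u

    1-translating : Translating 1#
    1-translating t = ≈-trans (φ-θ t 1#) (∙-congˡ (φ-cong (θ-fixes-1 θ θ-0 θ-+ θ-fixes-0 θ-scale t)))

    0-translating : Translating 0#
    0-translating t = ≈-trans (φ-cong (+-identityˡ t)) (≈-sym (≈-trans (∙-congˡ φ-0) (identityʳ _)))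

    -- The relation for `1#` at `s ⁻¹ * t`, scaled by `s`.
    square-translating : ∀ {s} → Square s → Translating s
    square-translating {s} sq = Sum.[ (λ { refl → 0-translating }) , nonzero ]′ (toSum (s ≟ 0#))
      where
      nonzero : s ≢ 0# → Translating s
      nonzero s≢0 t = begin
        φ (s + t)                       ≈⟨ φ-cong (cong₂ _+_ (sym (*-identityʳ s)) t≡s[s⁻¹t]) ⟩
        φ (s * 1# + s * (s ⁻¹ * t))     ≈⟨ φ-cong (solve 3 (λ s x y → s :* x :+ s :* y := s :* (x :+ y)) refl s _ _) ⟩
        φ (s * (1# + s ⁻¹ * t))         ≈⟨ φ-scale s≢0 sq (1-translating _) ⟩
        φ (s * (s ⁻¹ * t)) ∙ φ (s * 1#) ≈⟨ ∙-cong (φ-cong (sym t≡s[s⁻¹t])) (φ-cong (*-identityʳ s)) ⟩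
        φ t ∙ φ s                       ∎
        where
        t≡s[s⁻¹t] : t ≡ s * (s ⁻¹ * t)
        t≡s[s⁻¹t] = sym (trans (sym (*-assoc s _ t)) (trans (cong (_* t) (*-inverseʳ s≢0)) (*-identityˡ t)))

    -- Adding `v` is right multiplication by `φ v`, so subtracting `v` is right multiplication by
    -- its inverse; this is used at `t` and at 0.
    difference-translating : ∀ {u v} → Translating u → Translating v → Translating (u - v)
    difference-translating {u} {v} U V t = begin
      φ (u - v + t)                        ≈⟨ φ-cong (solve 3 (λ u v t → u :- v :+ t := u :+ (t :- v)) refl u v t) ⟩
      φ (u + (t - v))                      ≈⟨ U (t - v) ⟩
      φ (t - v) ∙ φ u                      ≈⟨ ∙-congʳ (φ-∸ t) ⟩
      φ t ∙ inv (φ v) ∙ φ u                ≈⟨ assoc _ _ _ ⟩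
      φ t ∙ (inv (φ v) ∙ φ u)              ≈⟨ ∙-congˡ (∙-congʳ (≈-sym (≈-trans (φ-∸ 0#) (≈-trans (∙-congʳ φ-0) (identityˡ _))))) ⟩
      φ t ∙ (φ (0# - v) ∙ φ u)             ≈⟨ ∙-congˡ (≈-sym (U (0# - v))) ⟩
      φ t ∙ φ (u + (0# - v))               ≈⟨ ∙-congˡ (φ-cong (solve 2 (λ u v → u :+ (con 0ℤ :- v) := u :- v) refl u v)) ⟩
      φ t ∙ φ (u - v)                      ∎
      where
      φ-∸ : ∀ t → φ (t - v) ≈ φ t ∙ inv (φ v)
      φ-∸ t = begin
        φ (t - v)                          ≈⟨ ≈-sym (//-rightDividesʳ (φ v) (φ (t - v))) ⟩
        φ (t - v) ∙ φ v ∙ inv (φ v)        ≈⟨ ∙-congʳ (≈-sym (V (t - v))) ⟩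
        φ (v + (t - v)) ∙ inv (φ v)        ≈⟨ ∙-congʳ (φ-cong (solve 2 (λ v t → v :+ (t :- v) := t) refl v t)) ⟩
        φ t ∙ inv (φ v)                    ∎

    all-translating : ∀ w → Translating w
    all-translating w = subst Translating (sym (difference-of-squares w))
      (difference-translating (square-translating (_ , refl)) (square-translating (_ , refl)))

    a≡b : a ≡ b
    a≡b = f-additive⇒a≡b λ y z → trans (cong (f a b) (solve 2 (λ y z → y :+ z := y :- :- z) refl y z))
      (trans (f-minus (- z) y) (cong (λ w → f a b y + f a b w) (solve 1 (λ z → con 0ℤ :- :- z := z) refl z)))
      where
      -- The map φ turns sums into products in reverse order, so the product of `φ (x ⋆ 0#)` and
      -- `φ (0# ⋆ y)` pulls back to a sum in the field.
      split : ∀ x y → x ⋆ y ≡ f a b y + x ⋆ 0#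
      split x y = φ-injective (≈-trans (φ-quadOp x y)
        (≈-trans (∙-congˡ (φ-cong (quadOp-0ˡ a b y))) (≈-sym (all-translating (f a b y) (x ⋆ 0#)))))
      f-minus : ∀ x y → f a b (y - x) ≡ f a b y + f a b (0# - x)
      f-minus x y = multiple 1# (trans (sym (quadOp-f a b x y)) (trans (split x y) (cong (λ w → f a b y + w) (quadOp-f a b x 0#))))
        (solve 4 (λ x p q r → p :- (q :+ r) := one :* (x :+ p :- (q :+ (x :+ r)))) refl x _ _ _)

  isotopicToGroup⇒a≡b : ∀ {a b} → Paired a b → Paired (1# - a) (1# - b) → IsotopicToGroup (quadOp a b) → a ≡ b
  isotopicToGroup⇒a≡b {a} {b} p q (G , α , β , γ , isotopy) =
    NormalizedIsotopy.a≡b p q G φ φ-injective φ-surjective φ-0 φ-quadOp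
    where
    open Group G using (_≈_; _∙_; ε; assoc; identityˡ; identityʳ; inverseˡ; inverseʳ; ∙-cong; ∙-congˡ; ∙-congʳ)
      renaming (_⁻¹ to inv; sym to ≈-sym; trans to ≈-trans; reflexive to ≈-reflexive)
    open Algebra.Properties.Group G using (∙-cancelˡ; ∙-cancelʳ; \\-leftDividesʳ; //-rightDividesʳ)
    open Relation.Binary.Reasoning.Setoid (Group.setoid G)
    module α = Bijection α
    module β = Bijection β
    module γ = Bijection γ
    φ : Carrier → Group.Carrier G
    -- The isotopy is normalised so that the idempotent 0 goes to the identity: `α` is divided by
    -- its value at 0 on the left and `β` by its value at 0 on the right.
    φ u = inv (α.to 0#) ∙ γ.to u ∙ inv (β.to 0#)
    φ-injective : ∀ {x y} → φ x ≈ φ y → x ≡ y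
    φ-injective e = γ.injective (∙-cancelˡ _ _ _ (∙-cancelʳ _ _ _ e))
    φ-surjective : ∀ g → ∃ λ x → φ x ≈ g
    φ-surjective g with γ.strictlySurjective (α.to 0# ∙ (g ∙ β.to 0#))
    ... | x , e = x , (begin
      inv (α.to 0#) ∙ γ.to x ∙ inv (β.to 0#)                              ≈⟨ ∙-congʳ (∙-congˡ e) ⟩
      inv (α.to 0#) ∙ (α.to 0# ∙ (g ∙ β.to 0#)) ∙ inv (β.to 0#)           ≈⟨ ∙-congʳ (\\-leftDividesʳ _ _) ⟩
      g ∙ β.to 0# ∙ inv (β.to 0#)                                         ≈⟨ //-rightDividesʳ _ _ ⟩
      g                                                                   ∎)
    φ-split : ∀ x y → φ (quadOp a b x y) ≈ (inv (α.to 0#) ∙ α.to x) ∙ (β.to y ∙ inv (β.to 0#))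
    φ-split x y = begin
      inv (α.to 0#) ∙ γ.to (quadOp a b x y) ∙ inv (β.to 0#)               ≈⟨ ∙-congʳ (∙-congˡ (isotopy x y)) ⟩
      inv (α.to 0#) ∙ (α.to x ∙ β.to y) ∙ inv (β.to 0#)                   ≈⟨ ∙-congʳ (≈-sym (assoc _ _ _)) ⟩
      inv (α.to 0#) ∙ α.to x ∙ β.to y ∙ inv (β.to 0#)                     ≈⟨ assoc _ _ _ ⟩
      (inv (α.to 0#) ∙ α.to x) ∙ (β.to y ∙ inv (β.to 0#))                 ∎
    φ-⋆0 : ∀ x → φ (quadOp a b x 0#) ≈ inv (α.to 0#) ∙ α.to x
    φ-⋆0 x = ≈-trans (φ-split x 0#) (≈-trans (∙-congˡ (inverseʳ _)) (identityʳ _))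
    φ-0⋆ : ∀ y → φ (quadOp a b 0# y) ≈ β.to y ∙ inv (β.to 0#)
    φ-0⋆ y = ≈-trans (φ-split 0# y) (≈-trans (∙-congʳ (inverseˡ _)) (identityˡ _))
    φ-0 : φ 0# ≈ ε
    φ-0 = ≈-trans (≈-reflexive (cong φ (sym (quadOp-idempotent a b 0#)))) (≈-trans (φ-⋆0 0#) (inverseˡ _))
    φ-quadOp : ∀ x y → φ (quadOp a b x y) ≈ φ (quadOp a b x 0#) ∙ φ (quadOp a b 0# y)
    φ-quadOp x y = ≈-trans (φ-split x y) (≈-sym (∙-cong (φ-⋆0 x) (φ-0⋆ y)))

  -- The product is `(1 - a) x + a y`, so the additive group is reached by scaling the two
  -- arguments; scaling by 1 is the identity on the result.
  a≡b⇒isotopicToGroup : ∀ {a} → a ≢ 0# → 1# - a ≢ 0# → IsotopicToGroup (quadOp a a)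
  a≡b⇒isotopicToGroup {a} a≢0 1-a≢0 = CommutativeRing.+-group commutativeRing , scaling 1-a≢0 , scaling a≢0 , scaling 1≢0 ,
    λ x y → trans (*-identityˡ _) (trans (quadOp-diagonal a x y)
      (solve 3 (λ a x y → x :+ a :* (y :- x) := (one :- a) :* x :+ a :* y) refl a x y))
    where
    scaling : ∀ {s} → s ≢ 0# → Bijection (setoid Carrier) (Group.setoid (CommutativeRing.+-group commutativeRing))
    scaling {s} s≢0 = record
      { to = s *_
      ; cong = cong (s *_)
      ; bijective = *-cancelˡ s≢0 , λ y → s ⁻¹ * y , λ { refl →
          trans (sym (*-assoc s _ y)) (trans (cong (_* y) (*-inverseʳ s≢0)) (*-identityˡ y)) }
      }

theorem1p3 : (F : FiniteField) → let open FiniteField F in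
    order % 2 ≡ 1 →
    (a b : Carrier) →
    χ a ≡ χ b → χ a ≢ 0ℤ →
    χ (1# - a) ≡ χ (1# - b) → χ (1# - a) ≢ 0ℤ →
    let _∘_ = quadOp a b in
    (Medial _≡_ _∘_ ⇔ a ≡ b)
    × (LeftDistributive _∘_ ⇔ a ≡ b)
    × (RightDistributive _∘_ ⇔ a ≡ b)
    × (Commutative _≡_ _∘_ ⇔ (a + b ≡ 1# × (order % 4 ≡ 3 ⊎ a ≡ b)))
    × (Flexible _≡_ _∘_ ⇔
        (a ≡ b ⊎ (χ a ≡ 1ℤ × χ (1# - a) ≡ 1ℤ) ⊎ (a + b ≡ 1# × order % 4 ≡ 3)))
    × (Semisymmetric _∘_ ⇔ (a * a - a + 1# ≡ 0# × (a ≡ b ⊎ a + b ≡ 1#)))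
    × ((Idempotent _≡_ _∘_ × Commutative _≡_ _∘_ × Semisymmetric _∘_) ⇔
        ((HasCharacteristic 3 × a ≡ - 1# × b ≡ - 1#)
         ⊎ (Σ ℕ (λ p → HasCharacteristic p × 3 < p)
            × a + b ≡ 1# × a * b ≡ 1# × χ a ≡ -1ℤ × χ (- 1#) ≡ -1ℤ)))
    × ((Σ ℕ (λ p → HasCharacteristic p × 3 < p)
            × a + b ≡ 1# × a * b ≡ 1# × χ a ≡ -1ℤ × χ (- 1#) ≡ -1ℤ) → a ≢ b)
    × (IsotopicToGroup _∘_ ⇔ a ≡ b)
theorem1p3 F odd a b χa≡χb χa≢0 χ1-a≡χ1-b χ1-a≢0 =
    mk⇔ (leftDistributive⇒a≡b p q ∘ medial⇒leftDistributive) (λ { refl → diagonal-medial a })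
  , mk⇔ (leftDistributive⇒a≡b p q) (λ { refl → medial⇒leftDistributive (diagonal-medial a) })
  , mk⇔ (rightDistributive⇒a≡b p q) (λ { refl → medial⇒rightDistributive (diagonal-medial a) })
  , mk⇔ (commutative⇒ p q) (λ (e , h) → commutative⇐ e h)
  , mk⇔ (flexible⇒ p q) (flexible⇐ p q)
  , mk⇔ (semisymmetric⇒ p q) (semisymmetric⇐ p q)
  , mk⇔ (λ (_ , comm , semi) → let e , h = commutative⇒ p q comm in steiner⇒ p e h (proj₁ (semisymmetric⇒ p q semi)))
        (λ st → let (e , h) , semi = steiner⇐ st in quadOp-idempotent a b , commutative⇐ e h , semisymmetric⇐ p q semi)
  , (λ (char>3 , e₁ , e₂ , _) → characteristic>3⇒a≢b char>3 e₁ e₂)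
  , mk⇔ (isotopicToGroup⇒a≡b p q) (λ { refl → a≡b⇒isotopicToGroup (Paired⇒≢0 p) (Paired⇒≢0 q) })
  where
  open FiniteField F
  open Isotopy F odd
  p : Paired a b
  p = χ≡⇒Paired χa≡χb χa≢0
  q : Paired (1# - a) (1# - b)
  q = χ≡⇒Paired χ1-a≡χ1-b χ1-a≢0
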